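{- Let $T=\{1243,1324,3142\}$. Then $$F_T(x)=\frac{1-3x+x^2}{1-x}\,C^3(x).$$
   Context: $S_n(T)$ denotes the set of permutations $\pi$ of $[n]=\{1,\dots,n\}$ (one-line notation) that avoid every pattern $\tau\in T$, i.e. no subsequence of $\pi$ is order-isomorphic to $\tau$. $F_T(x)=\sum_{n\ge 0}|S_n(T)|x^n$, a formal power series, with $|S_0(T)|=1$. $C(x)=\frac{1-\sqrt{1-4x}}{2x}=\sum_{n\ge0}\frac{1}{n+1}\binom{2n}{n}x^n$ is the generating function of the Catalan numbers, and $C^3(x)=(C(x))^3$. -}

module Defs where

open import Data.Fin.Base as Fin using (Fin; toℕ)
import Data.Fin.Properties as Fin
open import Data.Integer.Base as ℤ using (ℤ; +_; 0ℤ)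
import Data.Integer.Properties as ℤ
open import Data.List.Base as List using (List; []; _∷_; length; filter)
open import Data.List.Relation.Unary.All as All using (All)
open import Data.Nat.Base as ℕ using (ℕ; zero; suc; _∸_)
open import Data.Nat.Combinatorics using () renaming (_C_ to _choose_)
import Data.Nat.Properties as ℕ
open import Data.Product.Base using (∃; _×_; _,_; uncurry)
open import Data.Vec.Base as Vec using (Vec; []; _∷_; lookup)
open import Data.Vec.Relation.Unary.AllPairs using (AllPairs; allPairs?)
open import Data.Vec.Relation.Unary.Unique.Propositional using (Unique)
open import Function.Bundles using (_⇔_; mk⇔; Equivalence)
open import Relation.Nullary using (¬_; Dec; ¬?; _×-dec_; _→-dec_)
open import Relation.Nullary.Decidable using (map′)
open import Relation.Unary using (Pred; Decidable)

open import Algebra.Properties.Monoid.Sum ℤ.+-0-monoid using (sum)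

------------------------------------------------------------------------
-- Pattern avoidance

-- A permutation of [n] in one-line notation is a word of length n over
-- Fin n with distinct entries; the letter i ∈ [n] is represented by i - 1.
-- Patterns are lists of naturals, of which only the relative order of
-- the entries matters, so they can be written as usual: 1 ∷ 2 ∷ 4 ∷ 3 ∷ [].

OrderIsomorphicAt : ∀ {n} → Vec (Fin n) n → (τ : List ℕ) →
                    Vec (Fin n) (length τ) → Set
OrderIsomorphicAt π τ ps = ∀ a b →
  (lookup π (lookup ps a) Fin.< lookup π (lookup ps b)) ⇔
  (List.lookup τ a ℕ.< List.lookup τ b)

-- ps is the increasing list of positions of the subsequence.
Contains : ∀ {n} → Vec (Fin n) n → List ℕ → Set
Contains {n} π τ = ∃ λ (ps : Vec (Fin n) (length τ)) →
  AllPairs Fin._<_ ps × OrderIsomorphicAt π τ ps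

Avoids : ∀ {n} → Vec (Fin n) n → List (List ℕ) → Set
Avoids π T = All (λ τ → ¬ Contains π τ) T

anyVec? : ∀ {n k p} {P : Pred (Vec (Fin n) k) p} → Decidable P → Dec (∃ P)
anyVec? {k = zero}  P? = map′ (λ p → [] , p) (λ { ([] , p) → p }) (P? [])
anyVec? {k = suc k} P? =
  map′ (λ { (x , xs , p) → (x ∷ xs) , p }) (λ { ((x ∷ xs) , p) → x , xs , p })
       (Fin.any? λ x → anyVec? λ xs → P? (x ∷ xs))

_⇔-dec_ : ∀ {a b} {A : Set a} {B : Set b} → Dec A → Dec B → Dec (A ⇔ B)
a? ⇔-dec b? =
  map′ (uncurry mk⇔) (λ e → Equivalence.to e , Equivalence.from e)
       ((a? →-dec b?) ×-dec (b? →-dec a?))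

contains? : ∀ {n} (π : Vec (Fin n) n) τ → Dec (Contains π τ)
contains? π τ = anyVec? λ ps →
  allPairs? Fin._<?_ ps ×-dec
  (Fin.all? λ a → Fin.all? λ b →
    (lookup π (lookup ps a) Fin.<? lookup π (lookup ps b)) ⇔-dec
    (List.lookup τ a ℕ.<? List.lookup τ b))

avoids? : ∀ {n} (π : Vec (Fin n) n) T → Dec (Avoids π T)
avoids? π = All.all? (λ τ → ¬? (contains? π τ))

unique? : ∀ {n k} → Decidable (Unique {A = Fin n} {n = k})
unique? = allPairs? λ i j → ¬? (i Fin.≟ j)

-- All words of length k over Fin n, each listed exactly once.
words : ∀ n k → List (Vec (Fin n) k)
words n zero    = [] ∷ []
words n (suc k) = List.cartesianProductWith _∷_ (List.allFin n) (words n k)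

S : ∀ n → List (List ℕ) → List (Vec (Fin n) n)
S n T = filter (λ π → unique? π ×-dec avoids? π T) (words n n)

------------------------------------------------------------------------
-- Formal power series over ℤ, as coefficient sequences

PowerSeries : Set
PowerSeries = ℕ → ℤ

infixl 6 _+_ _-_
infixl 7 _*_ _/_
infixr 8 _^_

con : ℕ → PowerSeries
con c zero    = + c
con c (suc _) = 0ℤ

x : PowerSeries
x 1 = + 1
x _ = 0ℤ

_+_ _-_ _*_ : PowerSeries → PowerSeries → PowerSeries
(f + g) n = f n ℤ.+ g n
(f - g) n = f n ℤ.- g n
(f * g) n = sum {suc n} λ i → f (toℕ i) ℤ.* g (n ∸ toℕ i)

_^_ : PowerSeries → ℕ → PowerSeries
f ^ zero  = con 1
f ^ suc k = f * f ^ k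

-- The geometric series Σₖ (1 - f)ᵏ, which is the multiplicative inverse of f
-- when f has constant term 1 (and is meaningless otherwise).  In that case
-- (1 - f)ᵏ has order at least k, so the coefficient of xⁿ only involves k ≤ n.
recip : PowerSeries → PowerSeries
recip f n = sum {suc n} λ k → ((con 1 - f) ^ toℕ k) n

_/_ : PowerSeries → PowerSeries → PowerSeries
f / g = f * recip g

------------------------------------------------------------------------
-- The two generating functions

F : List (List ℕ) → PowerSeries
F T n = + length (S n T)

-- The division is exact: n + 1 divides (2n choose n).
C : PowerSeries
C n = + (((2 ℕ.* n) choose n) ℕ./ suc n)

module Submission where

-- Build permutations from right to left: prepend a value v and raise the
-- entries ≥ v.  In a T-avoiding permutation of length n, the values v that may
-- be prepended are those in an interval m, …, m + a = n, where the entries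
-- m, …, n - 1 occur in increasing order, together with s sporadic values < m.
-- The pair (a , s) determines the pairs of the children:
--   (a , s) ↦ (1 , a + s), (2 , 0), …, (a , 0), (a + 1 , s), (0 , 1)ˢ,
-- with (a + 1 , s) present only for a ≥ 1.  Since the dependence on s is affine,
-- the generating function of the tree below (a , s) is
--   Cᵃ⁺¹ + x Cᵃ⁺⁴ - D + s D for a ≥ 1, and C + x C⁴ - D + s x C³ for a = 0,
-- where D = x C³ / (1 - x).  The root is (0 , 0), and C + x C⁴ = (1 - x) C³.

open import Defs
open import Data.Empty using (⊥; ⊥-elim)
open import Data.Fin.Base as Fin using (Fin; zero; suc; toℕ; punchIn; fromℕ<)
open import Data.Fin.Patterns using (0F; 1F; 2F; 3F)
import Data.Fin.Properties as Fin
open import Data.Integer.Base as ℤ using (ℤ; 0ℤ; 1ℤ; -1ℤ; +_)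
import Data.Integer.Properties as ℤ
import Data.Integer.Tactic.RingSolver as ℤ
open import Data.List.Base as List using (List; []; _∷_; _++_; length; map; concatMap; upTo)
open import Data.List.Membership.Propositional using (_∈_; lose)
open import Data.List.Membership.Propositional.Properties
open import Data.List.Membership.Propositional.Properties.WithK using (unique∧set⇒bag)
open import Data.List.Properties using (length-++; length-map; length-upTo; map-++; map-∘; map-id)
open import Data.List.Relation.Binary.BagAndSetEquality using (∼bag⇒↭)
open import Data.List.Relation.Binary.Permutation.Propositional.Properties using (↭-length)
open import Data.List.Relation.Unary.All as All using (All; []; _∷_)
import Data.List.Relation.Unary.All.Properties as All
open import Data.List.Relation.Unary.AllPairs using ([]; _∷_)
open import Data.List.Relation.Unary.Any using (here; there)
open import Data.List.Relation.Unary.Unique.Propositional using (Unique)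
import Data.List.Relation.Unary.Unique.Propositional.Properties as Unique
open import Data.Nat.Base as ℕ using (ℕ; zero; suc; _≤_; _<_; z≤n; s≤s; s≤s⁻¹)
open import Data.Nat.Combinatorics using (nCk+nC[k+1]≡[n+1]C[k+1]; nCk≡nC[n∸k]; nCn≡1; nC1≡n; k>n⇒nCk≡0) renaming (_C_ to _choose_)
import Data.Nat.DivMod as ℕ
import Data.Nat.Properties as ℕ
import Data.Nat.Tactic.RingSolver as ℕ
open import Data.Product.Base using (∃; ∃₂; _×_; _,_; proj₁; proj₂)
open import Data.Sum.Base using (_⊎_; inj₁; inj₂)
open import Data.Vec.Base as Vec using (Vec; []; _∷_; lookup)
import Data.Vec.Properties as Vec
open import Data.Vec.Relation.Unary.All as VecAll using ([]; _∷_)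
import Data.Vec.Relation.Unary.All.Properties as VecAll
open import Data.Vec.Relation.Unary.AllPairs as VecAllPairs using ([]; _∷_)
import Data.Vec.Relation.Unary.Unique.Propositional as VecUnique
import Data.Vec.Relation.Unary.Unique.Propositional.Properties as VecUnique
open import Function.Base using (_∘_)
open import Function.Bundles using (_⇔_; mk⇔; Equivalence)
open import Relation.Binary.Definitions using (tri<; tri≈; tri>)
open import Relation.Binary.PropositionalEquality
open import Relation.Nullary using (¬_; Dec; yes; no; contradiction; _×-dec_)
open import Relation.Nullary.Decidable using (from-yes)
open import Algebra.Properties.Monoid.Sum ℤ.+-0-monoid using (sum; sum-cong-≗)

open ≡-Reasoning

-- A prepended v can only be the first letter of a forbidden pattern: the 1 of 1243, the 1 of 1324
-- or the 3 of 3142. Hence v is allowed exactly when the values from v on contain neither 132 nor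
-- 213 and v does not fit between the 2 and the 3 of a 132.
--
-- That the pair (a , s) suffices rests on two facts about positions, which the induction has to
-- carry along: the maximum precedes the entry w for every sporadic site w, and, if a ≥ 1, the
-- entries from m on precede all entries in [w, m).
--
-- The series come from solving the succession rule. Let D be the slope in s for a ≥ 1 and E the
-- series of (0 , 1). Comparing coefficients of s gives D = x (2 D + E). At s = 0, the rules for a +
-- 1 and a differ by W(a+1) - W(a) = x W(a+2) + x D, so K = W + D satisfies K(a+1) = K(a) + x
-- K(a+2). Powers of C solve this, up to a factor free of a, which the rule for (0 , 0) determines
-- as C + x C⁴; then E = C³ - D. The proof verifies this solution coefficient by coefficient.

private variable
  n : ℕ
  A B : Set

-- Powers of the Catalan series

-- G k is the coefficient sequence of the k-th power of the Catalan series C: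
-- the recurrence is Cᵏ⁺¹ = Cᵏ + x Cᵏ⁺².
G : ℕ → ℕ → ℕ
G zero    zero    = 1
G zero    (suc n) = 0
G (suc k) zero    = 1
G (suc k) (suc n) = G k (suc n) ℕ.+ G (suc (suc k)) n

-- Ballot numbers and the Catalan numbers

pascal : ∀ n k → suc n choose suc k ≡ n choose k ℕ.+ n choose suc k
pascal n k = sym (nCk+nC[k+1]≡[n+1]C[k+1] n k)

-- The absorption identity (k+1) C(n,k+1) = (n-k) C(n,k), kept free of subtraction.
choose-absorb : ∀ n k → suc k ℕ.* (n choose suc k) ℕ.+ k ℕ.* (n choose k) ≡ n ℕ.* (n choose k)
choose-absorb zero zero = refl
choose-absorb zero (suc k)
  rewrite k>n⇒nCk≡0 {0} {suc (suc k)} (s≤s z≤n) | k>n⇒nCk≡0 {0} {suc k} (s≤s z≤n)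
  = cong₂ ℕ._+_ (ℕ.*-zeroʳ k) (ℕ.*-zeroʳ k)
choose-absorb (suc n) zero = begin
  1 ℕ.* (suc n choose 1) ℕ.+ 0 ≡⟨ cong (λ c → 1 ℕ.* c ℕ.+ 0) (nC1≡n (suc n)) ⟩
  1 ℕ.* suc n ℕ.+ 0            ≡⟨ identities (suc n) ⟩
  suc n ℕ.* 1                  ∎
  where
  identities : ∀ n → 1 ℕ.* n ℕ.+ 0 ≡ n ℕ.* 1
  identities = ℕ.solve-∀
choose-absorb (suc n) (suc k) = begin
  suc (suc k) ℕ.* (suc n choose suc (suc k)) ℕ.+ suc k ℕ.* (suc n choose suc k)
    ≡⟨ cong₂ (λ a b → suc (suc k) ℕ.* a ℕ.+ suc k ℕ.* b) (pascal n (suc k)) (pascal n k) ⟩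
  suc (suc k) ℕ.* (c₁ ℕ.+ c₂) ℕ.+ suc k ℕ.* (c₀ ℕ.+ c₁)
    ≡⟨ regroup k c₀ c₁ c₂ ⟩
  (suc (suc k) ℕ.* c₂ ℕ.+ suc k ℕ.* c₁) ℕ.+ (suc k ℕ.* c₁ ℕ.+ k ℕ.* c₀) ℕ.+ (c₀ ℕ.+ c₁)
    ≡⟨ cong₂ (λ a b → a ℕ.+ b ℕ.+ (c₀ ℕ.+ c₁)) (choose-absorb n (suc k)) (choose-absorb n k) ⟩
  n ℕ.* c₁ ℕ.+ n ℕ.* c₀ ℕ.+ (c₀ ℕ.+ c₁)
    ≡⟨ collect n c₀ c₁ ⟩
  suc n ℕ.* (c₀ ℕ.+ c₁)
    ≡⟨ cong (suc n ℕ.*_) (sym (pascal n k)) ⟩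
  suc n ℕ.* (suc n choose suc k) ∎
  where
  c₀ = n choose k
  c₁ = n choose suc k
  c₂ = n choose suc (suc k)
  regroup : ∀ k c₀ c₁ c₂ → suc (suc k) ℕ.* (c₁ ℕ.+ c₂) ℕ.+ suc k ℕ.* (c₀ ℕ.+ c₁)
          ≡ (suc (suc k) ℕ.* c₂ ℕ.+ suc k ℕ.* c₁) ℕ.+ (suc k ℕ.* c₁ ℕ.+ k ℕ.* c₀) ℕ.+ (c₀ ℕ.+ c₁)
  regroup = ℕ.solve-∀
  collect : ∀ n c₀ c₁ → n ℕ.* c₁ ℕ.+ n ℕ.* c₀ ℕ.+ (c₀ ℕ.+ c₁) ≡ suc n ℕ.* (c₀ ℕ.+ c₁)
  collect = ℕ.solve-∀

central-choose-sym : ∀ n → suc (2 ℕ.* n) choose suc n ≡ suc (2 ℕ.* n) choose n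
central-choose-sym n = begin
  suc (2 ℕ.* n) choose suc n                     ≡⟨ nCk≡nC[n∸k] (s≤s (ℕ.m≤m+n n (n ℕ.+ 0))) ⟩
  suc (2 ℕ.* n) choose (suc (2 ℕ.* n) ℕ.∸ suc n) ≡⟨ cong (suc (2 ℕ.* n) choose_) (ℕ.m+n∸m≡n (suc n) (n ℕ.+ 0)) ⟩
  suc (2 ℕ.* n) choose (n ℕ.+ 0)                 ≡⟨ cong (suc (2 ℕ.* n) choose_) (ℕ.+-identityʳ n) ⟩
  suc (2 ℕ.* n) choose n                         ∎

-- The binomial coefficient at k - 1, with the value 0 at k = 0 that lets the ballot formula cover n
-- = 0.
choose-pred : ℕ → ℕ → ℕ
choose-pred n zero    = 0
choose-pred n (suc k) = n choose k

choose-zero : ∀ n → n choose 0 ≡ 1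
choose-zero n = trans (nCk≡nC[n∸k] {n = n} z≤n) (nCn≡1 n)

pascal-pred : ∀ n k → suc n choose k ≡ choose-pred n k ℕ.+ n choose k
pascal-pred n zero    = trans (choose-zero (suc n)) (sym (choose-zero n))
pascal-pred n (suc k) = pascal n k

-- Ballot numbers C(2n+k,n) - C(2n+k,n-1) obey, by Pascal's rule, the same recurrence as the
-- coefficients of powers of C.
G-ballot : ∀ n k → G (suc k) n ℕ.+ choose-pred (2 ℕ.* n ℕ.+ k) n ≡ (2 ℕ.* n ℕ.+ k) choose n
G-ballot zero k = sym (choose-zero k)
G-ballot (suc n) zero = begin
  G 2 n ℕ.+ ((2 ℕ.* suc n ℕ.+ 0) choose n)   ≡⟨ cong (λ t → G 2 n ℕ.+ (t choose n)) (double n) ⟩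
  G 2 n ℕ.+ (suc N choose n)                 ≡⟨ cong (G 2 n ℕ.+_) (pascal-pred N n) ⟩
  G 2 n ℕ.+ (choose-pred N n ℕ.+ N choose n) ≡⟨ ℕ.+-assoc (G 2 n) _ _ ⟨
  G 2 n ℕ.+ choose-pred N n ℕ.+ N choose n   ≡⟨ cong (ℕ._+ N choose n) (G-ballot n 1) ⟩
  -- The power C⁰ contributes nothing in positive degree. The second summand that Pascal's rule
  -- needs comes from the symmetry of row 2n + 1 about its middle.
  N choose n ℕ.+ N choose n                  ≡⟨ cong₂ ℕ._+_ refl middle ⟩
  N choose n ℕ.+ N choose suc n              ≡⟨ pascal N n ⟨
  suc N choose suc n                         ≡⟨ cong (_choose suc n) (double n) ⟨
  (2 ℕ.* suc n ℕ.+ 0) choose suc n           ∎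
  where
  N = 2 ℕ.* n ℕ.+ 1
  double : ∀ n → 2 ℕ.* suc n ℕ.+ 0 ≡ suc (2 ℕ.* n ℕ.+ 1)
  double = ℕ.solve-∀
  middle : N choose n ≡ N choose suc n
  middle rewrite ℕ.+-comm (2 ℕ.* n) 1 = sym (central-choose-sym n)
G-ballot (suc n) (suc k) = begin
  G (suc k) (suc n) ℕ.+ G (suc (suc (suc k))) n ℕ.+ ((2 ℕ.* suc n ℕ.+ suc k) choose n)
    ≡⟨ cong (λ t → G (suc k) (suc n) ℕ.+ G (suc (suc (suc k))) n ℕ.+ (t choose n)) (top n k) ⟩
  G (suc k) (suc n) ℕ.+ G (suc (suc (suc k))) n ℕ.+ (suc N choose n)
    ≡⟨ cong (G (suc k) (suc n) ℕ.+ G (suc (suc (suc k))) n ℕ.+_) (pascal-pred N n) ⟩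
  G (suc k) (suc n) ℕ.+ G (suc (suc (suc k))) n ℕ.+ (choose-pred N n ℕ.+ N choose n)
    ≡⟨ regroup (G (suc k) (suc n)) _ _ _ ⟩
  (G (suc (suc (suc k))) n ℕ.+ choose-pred N n) ℕ.+ (G (suc k) (suc n) ℕ.+ N choose n)
    ≡⟨ cong₂ ℕ._+_ (G-ballot n (suc (suc k)))
         (subst (λ t → G (suc k) (suc n) ℕ.+ t choose n ≡ t choose suc n) (same n k) (G-ballot (suc n) k)) ⟩
  N choose n ℕ.+ N choose suc n
    ≡⟨ pascal N n ⟨
  suc N choose suc n
    ≡⟨ cong (_choose suc n) (top n k) ⟨
  (2 ℕ.* suc n ℕ.+ suc k) choose suc n ∎
  where
  N = 2 ℕ.* n ℕ.+ suc (suc k)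
  top : ∀ n k → 2 ℕ.* suc n ℕ.+ suc k ≡ suc (2 ℕ.* n ℕ.+ suc (suc k))
  top = ℕ.solve-∀
  same : ∀ n k → 2 ℕ.* suc n ℕ.+ k ≡ 2 ℕ.* n ℕ.+ suc (suc k)
  same = ℕ.solve-∀
  regroup : ∀ a b c d → a ℕ.+ b ℕ.+ (c ℕ.+ d) ≡ (b ℕ.+ c) ℕ.+ (a ℕ.+ d)
  regroup = ℕ.solve-∀

-- The ballot formula at k = 0 combined with absorption, which relates the two binomials in it. In
-- this form the division in the definition of `C` is visibly exact.
suc*G₁ : ∀ n → G 1 n ℕ.* suc n ≡ (2 ℕ.* n) choose n
suc*G₁ zero = refl
suc*G₁ (suc n) = ℕ.+-cancelʳ-≡ (suc n ℕ.* c) _ _ (begin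
  g ℕ.* suc (suc n) ℕ.+ suc n ℕ.* c        ≡⟨ cong (g ℕ.* suc (suc n) ℕ.+_) absorbed ⟩
  g ℕ.* suc (suc n) ℕ.+ suc (suc n) ℕ.* c₀ ≡⟨ collect (suc (suc n)) g c₀ ⟩
  suc (suc n) ℕ.* (g ℕ.+ c₀)               ≡⟨ cong (suc (suc n) ℕ.*_) ballot ⟩
  suc (suc n) ℕ.* c                        ≡⟨⟩
  c ℕ.+ suc n ℕ.* c                        ∎)
  where
  g  = G 1 (suc n)
  c  = (2 ℕ.* suc n) choose suc n
  c₀ = (2 ℕ.* suc n) choose n
  ballot : g ℕ.+ c₀ ≡ c
  ballot = subst (λ t → g ℕ.+ t choose n ≡ t choose suc n) (ℕ.+-identityʳ (2 ℕ.* suc n)) (G-ballot (suc n) 0)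
  split : ∀ n c₀ → 2 ℕ.* suc n ℕ.* c₀ ≡ suc (suc n) ℕ.* c₀ ℕ.+ n ℕ.* c₀
  split = ℕ.solve-∀
  absorbed : suc n ℕ.* c ≡ suc (suc n) ℕ.* c₀
  absorbed = ℕ.+-cancelʳ-≡ (n ℕ.* c₀) _ _ (trans (choose-absorb (2 ℕ.* suc n) n) (split n c₀))
  collect : ∀ m g c → g ℕ.* m ℕ.+ m ℕ.* c ≡ m ℕ.* (g ℕ.+ c)
  collect = ℕ.solve-∀

G₁-catalan : ∀ n → ((2 ℕ.* n) choose n) ℕ./ suc n ≡ G 1 n
G₁-catalan n = trans (ℕ./-congˡ (sym (suc*G₁ n))) (ℕ.m*n/n≡m (G 1 n) (suc n))

-- Power series

delay : PowerSeries → PowerSeries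
delay f zero    = 0ℤ
delay f (suc n) = f n

*-cong : ∀ {f f′ g g′} → f ≗ f′ → g ≗ g′ → f * g ≗ f′ * g′
*-cong f≗f′ g≗g′ n = sum-cong-≗ {suc n} (λ i → cong₂ ℤ._*_ (f≗f′ (toℕ i)) (g≗g′ (n ℕ.∸ toℕ i)))

-- By computation, a product at `suc n` is `f 0 * g (suc n)` plus the product of `f ∘ suc` and `g`
-- at `n`. Inductions on products therefore vary the left factor.
*-distribˡ-+ : ∀ f g h → f * (g + h) ≗ f * g + f * h
*-distribˡ-+ f g h zero = base (f 0) (g 0) (h 0)
  where
  base : ∀ a b c → a ℤ.* (b ℤ.+ c) ℤ.+ 0ℤ ≡ a ℤ.* b ℤ.+ 0ℤ ℤ.+ (a ℤ.* c ℤ.+ 0ℤ)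
  base = ℤ.solve-∀
*-distribˡ-+ f g h (suc n) =
  trans (cong (λ t → f 0 ℤ.* (g (suc n) ℤ.+ h (suc n)) ℤ.+ t) (*-distribˡ-+ (f ∘ suc) g h n))
        (step (f 0) (g (suc n)) (h (suc n)) _ _)
  where
  step : ∀ a b c p q → a ℤ.* (b ℤ.+ c) ℤ.+ (p ℤ.+ q) ≡ a ℤ.* b ℤ.+ p ℤ.+ (a ℤ.* c ℤ.+ q)
  step = ℤ.solve-∀

*-delay : ∀ f g → f * delay g ≗ delay (f * g)
*-delay f g zero          = trans (ℤ.+-identityʳ _) (ℤ.*-zeroʳ (f 0))
*-delay f g (suc zero)    =
  cong (λ t → f 0 ℤ.* g 0 ℤ.+ t) (*-delay (f ∘ suc) g 0)
*-delay f g (suc (suc n)) =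
  cong (λ t → f 0 ℤ.* g (suc n) ℤ.+ t) (*-delay (f ∘ suc) g (suc n))

*-identityʳ : ∀ f → f * con 1 ≗ f
*-identityʳ f zero    = trans (ℤ.+-identityʳ _) (ℤ.*-identityʳ (f 0))
*-identityʳ f (suc n) = trans (cong₂ ℤ._+_ (ℤ.*-zeroʳ (f 0)) (*-identityʳ (f ∘ suc) n))
                              (ℤ.+-identityˡ (f (suc n)))

con-* : ∀ c f n → (con c * f) n ≡ + c ℤ.* f n
con-* c f zero    = ℤ.+-identityʳ _
con-* c f (suc n) = trans (cong (λ t → + c ℤ.* f (suc n) ℤ.+ t) (vanish n)) (ℤ.+-identityʳ _)
  where
  vanish : ∀ n → ((λ _ → 0ℤ) * f) n ≡ 0ℤ
  vanish zero    = refl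
  vanish (suc n) = trans (ℤ.+-identityˡ _) (vanish n)

x∘suc : x ∘ suc ≗ con 1
x∘suc zero    = refl
x∘suc (suc n) = refl

x-* : ∀ f → x * f ≗ delay f
x-* f zero    = refl
x-* f (suc n) = begin
  0ℤ ℤ.+ ((x ∘ suc) * f) n ≡⟨ ℤ.+-identityˡ _ ⟩
  ((x ∘ suc) * f) n        ≡⟨ *-cong {g = f} x∘suc (λ _ → refl) n ⟩
  (con 1 * f) n            ≡⟨ con-* 1 f n ⟩
  1ℤ ℤ.* f n               ≡⟨ ℤ.*-identityˡ (f n) ⟩
  f n                      ∎

delay-cong : ∀ {f g} → f ≗ g → delay f ≗ delay g
delay-cong f≗g zero    = refl
delay-cong f≗g (suc n) = f≗g n

monomial : ℕ → PowerSeries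
monomial zero    = con 1
monomial (suc k) = delay (monomial k)

^-cong : ∀ {f g} → f ≗ g → ∀ k → f ^ k ≗ g ^ k
^-cong f≗g zero    = λ _ → refl
^-cong f≗g (suc k) = *-cong f≗g (^-cong f≗g k)

x^k : ∀ k → x ^ k ≗ monomial k
x^k zero    n = refl
x^k (suc k) n = trans (x-* (x ^ k) n) (delay-cong (x^k k) n)

sum-monomials : ∀ n → sum {suc n} (λ k → monomial (toℕ k) n) ≡ 1ℤ
sum-monomials zero    = refl
sum-monomials (suc n) = trans (ℤ.+-identityˡ _) (sum-monomials n)

1-[1-x] : con 1 - (con 1 - x) ≗ x
1-[1-x] zero    = refl
1-[1-x] (suc zero) = refl
1-[1-x] (suc (suc n)) = refl

-- The geometric series now runs over the powers of x, and in degree n only the power with k = n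
-- contributes.
recip-1-x : recip (con 1 - x) ≗ λ _ → 1ℤ
recip-1-x n = trans
  (sum-cong-≗ {suc n} (λ k → trans (^-cong 1-[1-x] (toℕ k) n) (x^k (toℕ k) n)))
  (sum-monomials n)

-- The powers of C as power series

Γ : ℕ → PowerSeries
Γ k n = + G k n

Γ₀ : con 1 ≗ Γ 0
Γ₀ zero    = refl
Γ₀ (suc n) = refl

Γ-rec : ∀ k → Γ (suc k) ≗ Γ k + delay (Γ (suc (suc k)))
Γ-rec zero    zero    = refl
Γ-rec (suc k) zero    = refl
Γ-rec k       (suc n) = refl

Γ₁-*-rec : ∀ k → Γ 1 * Γ (suc k) ≗ Γ 1 * Γ k + delay (Γ 1 * Γ (suc (suc k)))
Γ₁-*-rec k n = begin
  (Γ 1 * Γ (suc k)) n                                 ≡⟨ *-cong {f = Γ 1} (λ _ → refl) (Γ-rec k) n ⟩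
  (Γ 1 * (Γ k + delay (Γ (suc (suc k))))) n           ≡⟨ *-distribˡ-+ (Γ 1) (Γ k) (delay (Γ (suc (suc k)))) n ⟩
  (Γ 1 * Γ k) n ℤ.+ (Γ 1 * delay (Γ (suc (suc k)))) n ≡⟨ cong (λ t → (Γ 1 * Γ k) n ℤ.+ t) (*-delay (Γ 1) (Γ (suc (suc k))) n) ⟩
  (Γ 1 * Γ k) n ℤ.+ delay (Γ 1 * Γ (suc (suc k))) n   ∎

-- Multiplying by C preserves the recurrence between powers, so both sides satisfy it. Its two terms
-- lower k at the same degree, or the degree at a larger k, so the induction is lexicographic in (n
-- , k). This replaces any use of the quadratic equation for C or of associativity.
Γ₁-* : ∀ k n → (Γ 1 * Γ k) n ≡ Γ (suc k) n
Γ₁-* zero    n       = trans (*-cong {f = Γ 1} (λ _ → refl) (sym ∘ Γ₀) n) (*-identityʳ (Γ 1) n)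
Γ₁-* (suc k) zero    = refl
Γ₁-* (suc k) (suc n) = trans (Γ₁-*-rec k (suc n)) (cong₂ ℤ._+_ (Γ₁-* k (suc n)) (Γ₁-* (suc (suc k)) n))

C≗Γ₁ : C ≗ Γ 1
C≗Γ₁ n = cong +_ (G₁-catalan n)

C^ : ∀ k → C ^ k ≗ Γ k
C^ zero    n = Γ₀ n
C^ (suc k) n = trans (*-cong C≗Γ₁ (C^ k) n) (Γ₁-* k n)

-- The coefficients of x C³ / (1 - x).
δ : ℕ → ℤ
δ zero    = 0ℤ
δ (suc n) = δ n ℤ.+ Γ 3 n

-- The coefficients of the right-hand side

numerator : PowerSeries
numerator = con 1 - con 3 * x + x ^ 2

-- The sequence 1, -2, -1, -1, ..., that is, the partial sums of 1, -3, 1, 0, 0, ....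
quotient : PowerSeries
quotient zero          = 1ℤ
quotient (suc zero)    = + 2 ℤ.* -1ℤ
quotient (suc (suc n)) = -1ℤ

quotient-correct : numerator / (con 1 - x) ≗ quotient
quotient-correct n = trans (*-cong numerator-coefficients recip-1-x n) (partial-sums n)
  where
  coefficients : PowerSeries
  coefficients zero          = 1ℤ
  coefficients (suc zero)    = + 3 ℤ.* -1ℤ
  coefficients (suc (suc n)) = con 1 n
  numerator-coefficients : numerator ≗ coefficients
  numerator-coefficients zero          = refl
  numerator-coefficients (suc zero)    = refl
  numerator-coefficients (suc (suc n)) = begin
    0ℤ ℤ.- (con 3 * x) (suc (suc n)) ℤ.+ (x ^ 2) (suc (suc n))
      ≡⟨ cong₂ (λ a b → 0ℤ ℤ.- a ℤ.+ b) (con-* 3 x (suc (suc n))) (x^k 2 (suc (suc n))) ⟩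
    0ℤ ℤ.+ con 1 n
      ≡⟨ ℤ.+-identityˡ (con 1 n) ⟩
    con 1 n ∎
  partial-sums : coefficients * (λ _ → 1ℤ) ≗ quotient
  partial-sums zero          = refl
  partial-sums (suc zero)    = refl
  partial-sums (suc (suc n)) = cong (λ a → 1ℤ ℤ.+ (+ 3 ℤ.* -1ℤ ℤ.+ a)) (con-* 1 (λ _ → 1ℤ) n)

minus-ones-* : ∀ n → ((λ _ → -1ℤ) * Γ 3) n ≡ ℤ.- δ (suc n)
minus-ones-* zero    = refl
minus-ones-* (suc n) = trans (cong (λ t → -1ℤ ℤ.* Γ 3 (suc n) ℤ.+ t) (minus-ones-* n)) (collect (Γ 3 (suc n)) (δ (suc n)))
  where
  collect : ∀ a d → -1ℤ ℤ.* a ℤ.+ ℤ.- d ≡ ℤ.- (d ℤ.+ a)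
  collect = ℤ.solve-∀

-- The quotient is (1 - x) - x / (1 - x): the first part gives (1 - x) C³, the second gives the
-- series of `δ`.
quotient-* : ∀ n → (quotient * Γ 3) n ≡ Γ 3 n ℤ.- delay (Γ 3) n ℤ.- δ n
quotient-* zero          = refl
quotient-* (suc zero)    = refl
quotient-* (suc (suc n)) =
  trans (cong (λ t → 1ℤ ℤ.* Γ 3 (suc (suc n)) ℤ.+ (+ 2 ℤ.* -1ℤ ℤ.* Γ 3 (suc n) ℤ.+ t)) (minus-ones-* n))
        (collect (Γ 3 (suc (suc n))) (Γ 3 (suc n)) (δ (suc n)))
  where
  collect : ∀ a b d → 1ℤ ℤ.* a ℤ.+ (+ 2 ℤ.* -1ℤ ℤ.* b ℤ.+ ℤ.- d) ≡ a ℤ.- b ℤ.- (d ℤ.+ b)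
  collect = ℤ.solve-∀

-- The coefficients of Cᵃ⁺¹ + x Cᵃ⁺⁴.
K : ℕ → ℕ → ℤ
K a n = Γ (suc a) n ℤ.+ delay (Γ (4 ℕ.+ a)) n

-- Adding and subtracting x C³ allows the power recurrence to act twice: C + x C³ = C² and C² + x C⁴
-- = C³.
K₀ : ∀ n → K 0 n ≡ Γ 3 n ℤ.- delay (Γ 3) n
K₀ n = begin
  Γ 1 n ℤ.+ delay (Γ 4) n                             ≡⟨ insert (Γ 1 n) (delay (Γ 3) n) _ ⟩
  Γ 1 n ℤ.+ delay (Γ 3) n ℤ.+ delay (Γ 4) n ℤ.- delay (Γ 3) n
    ≡⟨ cong (λ t → t ℤ.+ delay (Γ 4) n ℤ.- delay (Γ 3) n) (Γ-rec 1 n) ⟨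
  Γ 2 n ℤ.+ delay (Γ 4) n ℤ.- delay (Γ 3) n ≡⟨ cong (ℤ._- delay (Γ 3) n) (Γ-rec 2 n) ⟨
  Γ 3 n ℤ.- delay (Γ 3) n ∎
  where
  insert : ∀ a b c → a ℤ.+ c ≡ a ℤ.+ b ℤ.+ c ℤ.- b
  insert = ℤ.solve-∀

rhs-coefficients : ∀ n → (numerator / (con 1 - x) * C ^ 3) n ≡ K 0 n ℤ.- δ n
rhs-coefficients n = begin
  (numerator / (con 1 - x) * C ^ 3) n ≡⟨ *-cong quotient-correct (C^ 3) n ⟩
  (quotient * Γ 3) n                  ≡⟨ quotient-* n ⟩
  Γ 3 n ℤ.- delay (Γ 3) n ℤ.- δ n     ≡⟨ cong (ℤ._- δ n) (K₀ n) ⟨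
  K 0 n ℤ.- δ n                       ∎

-- The generating tree

-- label m a ls stands for the sites m, …, m + a together with those in ls, so
-- that (a , length ls) is the pair (a , s) above.
record Label : Set where
  constructor label
  field
    base run : ℕ
    lows     : List ℕ

-- Meant for a run of length a = b + 1. Each child has run n + 1 - v, so the pairs are (a , 0), ...,
-- (2 , 0) in this order.
insides : ℕ → ℕ → List (ℕ × Label)
insides m zero    = []
insides m (suc b) = (suc m , label (suc m) (2 ℕ.+ b) []) ∷ insides (suc m) b

extensions : Label → List (ℕ × Label)
extensions (label m zero    ls) = []
extensions (label m (suc b) ls) = (m , label m (2 ℕ.+ b) ls) ∷ insides m b

restart : ℕ → ℕ → ℕ × Label
restart n v = v , label (suc n) 0 (suc v ∷ [])

-- A new maximum in front spoils the increasing order of the entries from m on, so the interval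
-- restarts at n and its former sites m, ..., n - 1 become sporadic.
kids : Label → List (ℕ × Label)
kids L@(label m a ls) =
  (m ℕ.+ a , label (m ℕ.+ a) 1 (map (m ℕ.+_) (upTo a) ++ ls)) ∷
  extensions L ++ map (restart (m ℕ.+ a)) ls

-- Counting descendants

total : (A → ℤ) → List A → ℤ
total w []       = 0ℤ
total w (a ∷ as) = w a ℤ.+ total w as

total-++ : ∀ (w : A → ℤ) as bs → total w (as ++ bs) ≡ total w as ℤ.+ total w bs
total-++ w []       bs = sym (ℤ.+-identityˡ _)
total-++ w (a ∷ as) bs = trans (cong (λ t → w a ℤ.+ t) (total-++ w as bs)) (sym (ℤ.+-assoc (w a) _ _))

total-map : ∀ (w : B → ℤ) (f : A → B) as → total w (map f as) ≡ total (w ∘ f) as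
total-map w f []       = refl
total-map w f (a ∷ as) = cong (λ t → w (f a) ℤ.+ t) (total-map w f as)

total-const : ∀ c (as : List A) → total (λ _ → c) as ≡ + length as ℤ.* c
total-const c []       = refl
total-const c (a ∷ as) = trans (cong (λ t → c ℤ.+ t) (total-const c as)) (sym (ℤ.suc-* (+ length as) c))

slope : ℕ → ℕ → ℤ
slope zero    k = delay (Γ 3) k
slope (suc a) k = δ k

-- The number of descendants in the k-th generation below a label.
weight : ℕ → Label → ℤ
weight k (label m a ls) = K a k ℤ.- δ k ℤ.+ + length ls ℤ.* slope a k

-- Both summands of `K` are powers of C with exponents moving along with the index, so the power
-- recurrence applies to each.
K-rec : ∀ b k → K (suc b) (suc k) ≡ K b (suc k) ℤ.+ K (2 ℕ.+ b) k
K-rec b k = trans (cong (λ t → Γ (2 ℕ.+ b) (suc k) ℤ.+ t) (Γ-rec (4 ℕ.+ b) k))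
                  (regroup (Γ (1 ℕ.+ b) (suc k)) (Γ (3 ℕ.+ b) k) (Γ (4 ℕ.+ b) k) (delay (Γ (6 ℕ.+ b)) k))
  where
  regroup : ∀ p q r s → (p ℤ.+ q) ℤ.+ (r ℤ.+ s) ≡ (p ℤ.+ r) ℤ.+ (q ℤ.+ s)
  regroup = ℤ.solve-∀

K₀-suc : ∀ k → K 0 (suc k) ≡ K 1 k ℤ.+ Γ 3 k
K₀-suc k = trans (cong (λ t → Γ 2 k ℤ.+ t) (Γ-rec 3 k)) (regroup (Γ 2 k) (Γ 3 k) (delay (Γ 5) k))
  where
  regroup : ∀ p q r → p ℤ.+ (q ℤ.+ r) ≡ (p ℤ.+ r) ℤ.+ q
  regroup = ℤ.solve-∀

K₀+delay : ∀ k → K 0 k ℤ.+ delay (Γ 3) k ≡ Γ 3 k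
K₀+delay k = trans (cong (λ t → t ℤ.+ delay (Γ 3) k) (K₀ k)) (cancel (Γ 3 k) (delay (Γ 3) k))
  where
  cancel : ∀ p q → p ℤ.- q ℤ.+ q ≡ p
  cancel = ℤ.solve-∀

-- By `K-rec` each term K (2 + b) k is a difference of consecutive values of `K` at `suc k`, and the
-- sum telescopes.
insides-total : ∀ k m b → total (weight k ∘ proj₂) (insides m b) ≡ K b (suc k) ℤ.- K 0 (suc k) ℤ.- + b ℤ.* δ k
insides-total k m zero    = sym (cancel (K 0 (suc k)) (δ k))
  where
  cancel : ∀ p d → p ℤ.- p ℤ.- 0ℤ ℤ.* d ≡ 0ℤ
  cancel = ℤ.solve-∀
insides-total k m (suc b) = begin
  K (2 ℕ.+ b) k ℤ.- δ k ℤ.+ 0ℤ ℤ.* δ k ℤ.+ total (weight k ∘ proj₂) (insides (suc m) b)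
    ≡⟨ cong (λ t → K (2 ℕ.+ b) k ℤ.- δ k ℤ.+ 0ℤ ℤ.* δ k ℤ.+ t) (insides-total k (suc m) b) ⟩
  K (2 ℕ.+ b) k ℤ.- δ k ℤ.+ 0ℤ ℤ.* δ k ℤ.+ (K b (suc k) ℤ.- K 0 (suc k) ℤ.- + b ℤ.* δ k)
    ≡⟨ collect (K (2 ℕ.+ b) k) (K b (suc k)) (K 0 (suc k)) (δ k) (+ b) ⟩
  K b (suc k) ℤ.+ K (2 ℕ.+ b) k ℤ.- K 0 (suc k) ℤ.- (1ℤ ℤ.+ + b) ℤ.* δ k
    ≡⟨ cong (λ t → t ℤ.- K 0 (suc k) ℤ.- + suc b ℤ.* δ k) (K-rec b k) ⟨
  K (suc b) (suc k) ℤ.- K 0 (suc k) ℤ.- + suc b ℤ.* δ k ∎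
  where
  collect : ∀ p q r d b → p ℤ.- d ℤ.+ 0ℤ ℤ.* d ℤ.+ (q ℤ.- r ℤ.- b ℤ.* d) ≡ q ℤ.+ p ℤ.- r ℤ.- (1ℤ ℤ.+ b) ℤ.* d
  collect = ℤ.solve-∀

-- Every restart is a node (0 , 1), whose series C + x C⁴ - D + x C³ collapses to C³ - D.
restarts-total : ∀ k n ls → total (weight k ∘ proj₂) (map (restart n) ls) ≡ + length ls ℤ.* (Γ 3 k ℤ.- δ k)
restarts-total k n ls = begin
  total (weight k ∘ proj₂) (map (restart n) ls)            ≡⟨ total-map _ (restart n) ls ⟩
  total (λ _ → K 0 k ℤ.- δ k ℤ.+ 1ℤ ℤ.* delay (Γ 3) k) ls  ≡⟨ total-const _ ls ⟩
  + length ls ℤ.* (K 0 k ℤ.- δ k ℤ.+ 1ℤ ℤ.* delay (Γ 3) k) ≡⟨ cong (λ t → + length ls ℤ.* t) (regroup (K 0 k) (δ k) (delay (Γ 3) k)) ⟩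
  + length ls ℤ.* (K 0 k ℤ.+ delay (Γ 3) k ℤ.- δ k)        ≡⟨ cong (λ t → + length ls ℤ.* (t ℤ.- δ k)) (K₀+delay k) ⟩
  + length ls ℤ.* (Γ 3 k ℤ.- δ k)                          ∎
  where
  regroup : ∀ p d q → p ℤ.- d ℤ.+ 1ℤ ℤ.* q ≡ p ℤ.+ q ℤ.- d
  regroup = ℤ.solve-∀

lows-length : ∀ m a ls → + length (map (m ℕ.+_) (upTo a) ++ ls) ≡ + a ℤ.+ + length ls
lows-length m a ls = cong +_ (trans (length-++ (map (m ℕ.+_) (upTo a)))
  (cong (ℕ._+ length ls) (trans (length-map (m ℕ.+_) (upTo a)) (length-upTo a))))

-- The a sites that become sporadic under the first child contribute a times `δ k`, which offsets
-- the `δ k` subtracted for each of the a children in `extensions`. The one left over combines with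
-- `Γ 3 k` from `K₀-suc` into `δ (suc k)`.
kids-total : ∀ k L → total (weight k ∘ proj₂) (kids L) ≡ weight (suc k) L
kids-total k L@(label m a ls) = begin
  K 1 k ℤ.- δ k ℤ.+ + length (map (m ℕ.+_) (upTo a) ++ ls) ℤ.* δ k ℤ.+ total w (extensions L ++ map (restart (m ℕ.+ a)) ls)
    ≡⟨ cong₂ (λ t u → K 1 k ℤ.- δ k ℤ.+ t ℤ.* δ k ℤ.+ u) (lows-length m a ls)
         (trans (total-++ w (extensions L) _) (cong (λ t → total w (extensions L) ℤ.+ t) (restarts-total k _ ls))) ⟩
  K 1 k ℤ.- δ k ℤ.+ (+ a ℤ.+ s) ℤ.* δ k ℤ.+ (total w (extensions L) ℤ.+ s ℤ.* (Γ 3 k ℤ.- δ k))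
    ≡⟨ finish a ⟩
  weight (suc k) L ∎
  where
  w = weight k ∘ proj₂
  s = + length ls
  finish : ∀ a → K 1 k ℤ.- δ k ℤ.+ (+ a ℤ.+ s) ℤ.* δ k ℤ.+ (total w (extensions (label m a ls)) ℤ.+ s ℤ.* (Γ 3 k ℤ.- δ k))
         ≡ weight (suc k) (label m a ls)
  finish zero = trans (collect (K 1 k) (Γ 3 k) (δ k) s) (cong (λ t → t ℤ.- δ (suc k) ℤ.+ s ℤ.* Γ 3 k) (sym (K₀-suc k)))
    where
    collect : ∀ p g d s → p ℤ.- d ℤ.+ (0ℤ ℤ.+ s) ℤ.* d ℤ.+ (0ℤ ℤ.+ s ℤ.* (g ℤ.- d))
            ≡ p ℤ.+ g ℤ.- (d ℤ.+ g) ℤ.+ s ℤ.* g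
    collect = ℤ.solve-∀
  finish (suc b) = begin
    K 1 k ℤ.- δ k ℤ.+ (1ℤ ℤ.+ + b ℤ.+ s) ℤ.* δ k ℤ.+ (K (2 ℕ.+ b) k ℤ.- δ k ℤ.+ s ℤ.* δ k ℤ.+ total w (insides m b) ℤ.+ s ℤ.* (Γ 3 k ℤ.- δ k))
      ≡⟨ cong (λ t → K 1 k ℤ.- δ k ℤ.+ (1ℤ ℤ.+ + b ℤ.+ s) ℤ.* δ k ℤ.+ (K (2 ℕ.+ b) k ℤ.- δ k ℤ.+ s ℤ.* δ k ℤ.+ t ℤ.+ s ℤ.* (Γ 3 k ℤ.- δ k)))
           (trans (insides-total k m b) (cong (λ t → K b (suc k) ℤ.- t ℤ.- + b ℤ.* δ k) (K₀-suc k))) ⟩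
    K 1 k ℤ.- δ k ℤ.+ (1ℤ ℤ.+ + b ℤ.+ s) ℤ.* δ k ℤ.+ (K (2 ℕ.+ b) k ℤ.- δ k ℤ.+ s ℤ.* δ k
      ℤ.+ (K b (suc k) ℤ.- (K 1 k ℤ.+ Γ 3 k) ℤ.- + b ℤ.* δ k) ℤ.+ s ℤ.* (Γ 3 k ℤ.- δ k))
      ≡⟨ collect (K 1 k) (K (2 ℕ.+ b) k) (K b (suc k)) (Γ 3 k) (δ k) (+ b) s ⟩
    K b (suc k) ℤ.+ K (2 ℕ.+ b) k ℤ.- δ (suc k) ℤ.+ s ℤ.* δ (suc k)
      ≡⟨ cong (λ t → t ℤ.- δ (suc k) ℤ.+ s ℤ.* δ (suc k)) (K-rec b k) ⟨
    K (suc b) (suc k) ℤ.- δ (suc k) ℤ.+ s ℤ.* δ (suc k) ∎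
    where
    collect : ∀ p q r g d b s → p ℤ.- d ℤ.+ (1ℤ ℤ.+ b ℤ.+ s) ℤ.* d ℤ.+ (q ℤ.- d ℤ.+ s ℤ.* d
              ℤ.+ (r ℤ.- (p ℤ.+ g) ℤ.- b ℤ.* d) ℤ.+ s ℤ.* (g ℤ.- d))
            ≡ r ℤ.+ q ℤ.- (d ℤ.+ g) ℤ.+ s ℤ.* (d ℤ.+ g)
    collect = ℤ.solve-∀

-- Prepending an entry

-- The action of `punchIn` on plain naturals, so that entries carry no bound in their type.
shift : ℕ → ℕ → ℕ
shift zero    y       = suc y
shift (suc v) zero    = zero
shift (suc v) (suc y) = suc (shift v y)

shift-mono-< : ∀ v {y z} → y < z → shift v y < shift v z
shift-mono-< zero    y<z                     = s≤s y<z
shift-mono-< (suc v) {zero}  {suc z} _         = s≤s z≤n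
shift-mono-< (suc v) {suc y} {suc z} (s≤s y<z) = s≤s (shift-mono-< v y<z)

shift-cancel-< : ∀ v {y z} → shift v y < shift v z → y < z
shift-cancel-< v {y} {z} lt with y ℕ.<? z
... | yes y<z = y<z
... | no  y≮z with ℕ.m≤n⇒m<n∨m≡n (ℕ.≮⇒≥ y≮z)
...   | inj₁ z<y  = contradiction lt (ℕ.<-asym (shift-mono-< v z<y))
...   | inj₂ refl = contradiction lt (ℕ.<-irrefl refl)

shift-injective : ∀ v {y z} → shift v y ≡ shift v z → y ≡ z
shift-injective v {y} {z} eq with ℕ.<-cmp y z
... | tri< y<z _ _ = contradiction eq (ℕ.<⇒≢ (shift-mono-< v y<z))
... | tri≈ _ y≡z _ = y≡z
... | tri> _ _ z<y = contradiction (sym eq) (ℕ.<⇒≢ (shift-mono-< v z<y))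

shift-below : ∀ {v y} → y < v → shift v y ≡ y
shift-below {suc v} {zero}  _         = refl
shift-below {suc v} {suc y} (s≤s y<v) = cong suc (shift-below y<v)

shift-above : ∀ {v y} → v ≤ y → shift v y ≡ suc y
shift-above {zero}          _         = refl
shift-above {suc v} {suc y} (s≤s v≤y) = cong suc (shift-above v≤y)

-- Raising the entries from v on leaves comparisons with a threshold w ≤ v unchanged; in the next
-- module a threshold u ≥ v moves to u + 1.
module _ {v w : ℕ} (w≤v : w ≤ v) where

  ≤-shift-low : ∀ {y} → w ≤ y → w ≤ shift v y
  ≤-shift-low {y} w≤y with y ℕ.<? v
  ... | yes y<v = subst (w ≤_) (sym (shift-below y<v)) w≤y
  ... | no  y≮v = subst (w ≤_) (sym (shift-above (ℕ.≮⇒≥ y≮v))) (ℕ.m≤n⇒m≤1+n w≤y)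

  shift-low-< : ∀ {y} → y < w → shift v y < w
  shift-low-< {y} y<w = subst (_< w) (sym (shift-below (ℕ.<-≤-trans y<w w≤v))) y<w

  ≤-shift-low⁻ : ∀ {y} → w ≤ shift v y → w ≤ y
  ≤-shift-low⁻ {y} le with y ℕ.<? w
  ... | yes y<w = contradiction (shift-low-< y<w) (ℕ.≤⇒≯ le)
  ... | no  y≮w = ℕ.≮⇒≥ y≮w

  shift-low-<⁻ : ∀ {y} → shift v y < w → y < w
  shift-low-<⁻ {y} lt with y ℕ.<? w
  ... | yes y<w = y<w
  ... | no  y≮w = contradiction (≤-shift-low (ℕ.≮⇒≥ y≮w)) (ℕ.<⇒≱ lt)

module _ {v u : ℕ} (v≤u : v ≤ u) where

  ≤-shift-high : ∀ {y} → u ≤ y → suc u ≤ shift v y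
  ≤-shift-high u≤y = subst (suc u ≤_) (sym (shift-above (ℕ.≤-trans v≤u u≤y))) (s≤s u≤y)

  shift-high-< : ∀ {y} → y < u → shift v y < suc u
  shift-high-< {y} y<u with y ℕ.<? v
  ... | yes y<v = subst (_< suc u) (sym (shift-below y<v)) (ℕ.m<n⇒m<1+n y<u)
  ... | no  y≮v = subst (_< suc u) (sym (shift-above (ℕ.≮⇒≥ y≮v))) (s≤s y<u)

  ≤-shift-high⁻ : ∀ {y} → suc u ≤ shift v y → u ≤ y
  ≤-shift-high⁻ {y} le with y ℕ.<? u
  ... | yes y<u = contradiction (shift-high-< y<u) (ℕ.≤⇒≯ le)
  ... | no  y≮u = ℕ.≮⇒≥ y≮u

  shift-high-<⁻ : ∀ {y} → shift v y < suc u → y < u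
  shift-high-<⁻ {y} lt with y ℕ.<? u
  ... | yes y<u = y<u
  ... | no  y≮u = contradiction (≤-shift-high (ℕ.≮⇒≥ y≮u)) (ℕ.<⇒≱ lt)

-- Avoidance and active values under prepending

prepend : ℕ → (Fin n → ℕ) → Fin (suc n) → ℕ
prepend v f zero    = v
prepend v f (suc i) = shift v (f i)

record Good (f : Fin n → ℕ) : Set where
  field
    no1243 : ∀ {i j k l} → i Fin.< j → j Fin.< k → k Fin.< l → f i < f j → f j < f l → f l < f k → ⊥
    no1324 : ∀ {i j k l} → i Fin.< j → j Fin.< k → k Fin.< l → f i < f k → f k < f j → f j < f l → ⊥
    no3142 : ∀ {i j k l} → i Fin.< j → j Fin.< k → k Fin.< l → f j < f l → f l < f i → f i < f k → ⊥

-- For a Good f, this says that prepend v f is Good as well.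
record Active (f : Fin n → ℕ) (v : ℕ) : Set where
  field
    no132  : ∀ {i j k} → i Fin.< j → j Fin.< k → v ≤ f i → f i < f k → f k < f j → ⊥
    no213  : ∀ {i j k} → i Fin.< j → j Fin.< k → v ≤ f j → f j < f i → f i < f k → ⊥
    no1v32 : ∀ {i j k} → i Fin.< j → j Fin.< k → f i < f k → f k < v → v ≤ f j → ⊥

open Good
open Active

module _ {f : Fin n → ℕ} {v : ℕ} where

  Good-tail : Good (prepend v f) → Good f
  Good-tail g .no1243 p q r s t u = no1243 g (s≤s p) (s≤s q) (s≤s r) (shift-mono-< v s) (shift-mono-< v t) (shift-mono-< v u)
  Good-tail g .no1324 p q r s t u = no1324 g (s≤s p) (s≤s q) (s≤s r) (shift-mono-< v s) (shift-mono-< v t) (shift-mono-< v u)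
  Good-tail g .no3142 p q r s t u = no3142 g (s≤s p) (s≤s q) (s≤s r) (shift-mono-< v s) (shift-mono-< v t) (shift-mono-< v u)

  Good-head : Good (prepend v f) → Active f v
  Good-head g .no132 p q v≤ s t =
    no1243 g {zero} (s≤s z≤n) (s≤s p) (s≤s q) (≤-shift-high ℕ.≤-refl v≤) (shift-mono-< v s) (shift-mono-< v t)
  Good-head g .no213 p q v≤ s t =
    no1324 g {zero} (s≤s z≤n) (s≤s p) (s≤s q) (≤-shift-high ℕ.≤-refl v≤) (shift-mono-< v s) (shift-mono-< v t)
  Good-head g .no1v32 p q s t v≤ =
    no3142 g {zero} (s≤s z≤n) (s≤s p) (s≤s q) (shift-mono-< v s) (shift-low-< ℕ.≤-refl t) (≤-shift-high ℕ.≤-refl v≤)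

  Good-prepend : Good f → Active f v → Good (prepend v f)
  Good-prepend g a .no1243 {zero}  {suc j} {suc k} {suc l} _ (s≤s q) (s≤s r) s t u =
    no132 a q r (≤-shift-high⁻ ℕ.≤-refl s) (shift-cancel-< v t) (shift-cancel-< v u)
  Good-prepend g a .no1243 {suc i} {suc j} {suc k} {suc l} (s≤s p) (s≤s q) (s≤s r) s t u =
    no1243 g p q r (shift-cancel-< v s) (shift-cancel-< v t) (shift-cancel-< v u)
  Good-prepend g a .no1324 {zero}  {suc j} {suc k} {suc l} _ (s≤s q) (s≤s r) s t u =
    no213 a q r (≤-shift-high⁻ ℕ.≤-refl s) (shift-cancel-< v t) (shift-cancel-< v u)
  Good-prepend g a .no1324 {suc i} {suc j} {suc k} {suc l} (s≤s p) (s≤s q) (s≤s r) s t u =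
    no1324 g p q r (shift-cancel-< v s) (shift-cancel-< v t) (shift-cancel-< v u)
  Good-prepend g a .no3142 {zero}  {suc j} {suc k} {suc l} _ (s≤s q) (s≤s r) s t u =
    no1v32 a q r (shift-cancel-< v s) (shift-low-<⁻ ℕ.≤-refl t) (≤-shift-high⁻ ℕ.≤-refl u)
  Good-prepend g a .no3142 {suc i} {suc j} {suc k} {suc l} (s≤s p) (s≤s q) (s≤s r) s t u =
    no3142 g p q r (shift-cancel-< v s) (shift-cancel-< v t) (shift-cancel-< v u)

IncreasingFrom : (Fin n → ℕ) → ℕ → Set
IncreasingFrom f v = ∀ {i j} → i Fin.< j → v ≤ f j → f j < f i → ⊥

NoDescentAcross : (Fin n → ℕ) → ℕ → ℕ → Set
NoDescentAcross f v u = ∀ {i j} → i Fin.< j → v ≤ f j → f j < u → u ≤ f i → ⊥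

NoAscentAcross : (Fin n → ℕ) → ℕ → ℕ → Set
NoAscentAcross f w v = ∀ {i j} → i Fin.< j → w ≤ f i → f i < v → v ≤ f j → ⊥

module _ {f : Fin n → ℕ} {v u : ℕ} (v≤u : v ≤ u) where

  -- The new front entry v lies below the site `suc u`, so it can only be the 1 in `no1v32`. The
  -- remaining two letters then form a descent across u among entries from v on.
  active-above : Active f u → NoDescentAcross f v u → Active (prepend v f) (suc u)
  active-above a d .no132 {zero} _ _ v≥ _ _ = contradiction v≤u (ℕ.<⇒≱ v≥)
  active-above a d .no132 {suc i} {suc j} {suc k} (s≤s p) (s≤s q) s t w =
    no132 a p q (≤-shift-high⁻ v≤u s) (shift-cancel-< v t) (shift-cancel-< v w)
  active-above a d .no213 {zero} {suc j} {suc k} p q s t w =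
    contradiction (ℕ.<-trans s t) (ℕ.≤⇒≯ v≤u)
  active-above a d .no213 {suc i} {suc j} {suc k} (s≤s p) (s≤s q) s t w =
    no213 a p q (≤-shift-high⁻ v≤u s) (shift-cancel-< v t) (shift-cancel-< v w)
  active-above a d .no1v32 {zero} {suc j} {suc k} _ (s≤s q) s t w =
    d q (≤-shift-high⁻ ℕ.≤-refl s) (shift-high-<⁻ v≤u t) (≤-shift-high⁻ v≤u w)
  active-above a d .no1v32 {suc i} {suc j} {suc k} (s≤s p) (s≤s q) s t w =
    no1v32 a p q (shift-cancel-< v s) (shift-high-<⁻ v≤u t) (≤-shift-high⁻ v≤u w)

  active-above⁻ : Active (prepend v f) (suc u) → Active f u × NoDescentAcross f v u
  active-above⁻ a = old , λ p v≤ s t → no1v32 a {zero} (s≤s z≤n) (s≤s p)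
      (≤-shift-high ℕ.≤-refl v≤) (shift-high-< v≤u s) (≤-shift-high v≤u t)
    where
    old : Active f u
    old .no132  p q s t w = no132 a (s≤s p) (s≤s q) (≤-shift-high v≤u s) (shift-mono-< v t) (shift-mono-< v w)
    old .no213  p q s t w = no213 a (s≤s p) (s≤s q) (≤-shift-high v≤u s) (shift-mono-< v t) (shift-mono-< v w)
    old .no1v32 p q s t w = no1v32 a (s≤s p) (s≤s q) (shift-mono-< v s) (shift-high-< v≤u t) (≤-shift-high v≤u w)

module _ {f : Fin n → ℕ} {v w : ℕ} (w≤v : w ≤ v) where

  -- The new front entry v lies at or above the site w. It can be the 1 of a 132, which
  -- `IncreasingFrom` excludes, or the 2 of a 213, which `NoAscentAcross` excludes.
  active-below : Active f w → IncreasingFrom f v → NoAscentAcross f w v → Active (prepend v f) w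
  active-below a inc asc .no132 {zero} {suc j} {suc k} _ (s≤s q) _ s t =
    inc q (≤-shift-high⁻ ℕ.≤-refl s) (shift-cancel-< v t)
  active-below a inc asc .no132 {suc i} {suc j} {suc k} (s≤s p) (s≤s q) s t u =
    no132 a p q (≤-shift-low⁻ w≤v s) (shift-cancel-< v t) (shift-cancel-< v u)
  active-below a inc asc .no213 {zero} {suc j} {suc k} _ (s≤s q) s t u =
    asc q (≤-shift-low⁻ w≤v s) (shift-low-<⁻ ℕ.≤-refl t) (≤-shift-high⁻ ℕ.≤-refl u)
  active-below a inc asc .no213 {suc i} {suc j} {suc k} (s≤s p) (s≤s q) s t u =
    no213 a p q (≤-shift-low⁻ w≤v s) (shift-cancel-< v t) (shift-cancel-< v u)
  active-below a inc asc .no1v32 {zero} {suc j} {suc k} _ _ s t _ =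
    contradiction (ℕ.<-trans s t) (ℕ.≤⇒≯ w≤v)
  active-below a inc asc .no1v32 {suc i} {suc j} {suc k} (s≤s p) (s≤s q) s t u =
    no1v32 a p q (shift-cancel-< v s) (shift-low-<⁻ w≤v t) (≤-shift-low⁻ w≤v u)

  active-below⁻ : Active (prepend v f) w → Active f w × IncreasingFrom f v × NoAscentAcross f w v
  active-below⁻ a = old ,
    (λ p s t → no132 a {zero} (s≤s z≤n) (s≤s p) w≤v (≤-shift-high ℕ.≤-refl s) (shift-mono-< v t)) ,
    (λ p s t u → no213 a {zero} (s≤s z≤n) (s≤s p) (≤-shift-low w≤v s) (shift-low-< ℕ.≤-refl t) (≤-shift-high ℕ.≤-refl u))
    where
    old : Active f w
    old .no132  p q s t u = no132 a (s≤s p) (s≤s q) (≤-shift-low w≤v s) (shift-mono-< v t) (shift-mono-< v u)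
    old .no213  p q s t u = no213 a (s≤s p) (s≤s q) (≤-shift-low w≤v s) (shift-mono-< v t) (shift-mono-< v u)
    old .no1v32 p q s t u = no1v32 a (s≤s p) (s≤s q) (shift-mono-< v s) (shift-low-< w≤v t) (≤-shift-low w≤v u)

-- Active sites of the nodes

Site : Label → ℕ → Set
Site (label m a ls) v = (m ≤ v × v ≤ m ℕ.+ a) ⊎ v ∈ ls

-- The last two fields are the facts about positions that survival of sites depends on: `max-first`
-- makes prepending a sporadic value destroy all but two sites, and `run-first` keeps sporadic sites
-- alive when m is prepended. The field `onto` supplies the entries that witness the loss of a site.
record State (f : Fin n → ℕ) (L : Label) : Set where
  open Label L
  field
    size       : base ℕ.+ run ≡ n
    bounded    : ∀ i → f i < n
    onto       : ∀ {y} → y < n → ∃ λ i → f i ≡ y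
    sound      : ∀ {v} → Site L v → Active f v
    complete   : ∀ {v} → v ≤ n → Active f v → Site L v
    increasing : IncreasingFrom f base
    lows<base  : ∀ {w} → w ∈ lows → w < base
    unique     : Unique lows
    max-first  : ∀ {w} → w ∈ lows → ∃₂ λ i j → i Fin.< j × f j ≡ w × w < f i × suc (f i) ≡ n
    run-first  : 0 < run → ∀ {w} → w ∈ lows → NoAscentAcross f w base
open State

bounded-prepend : ∀ {f : Fin n → ℕ} {v} → v ≤ n → (∀ i → f i < n) → ∀ i → prepend v f i < suc n
bounded-prepend v≤n b zero    = s≤s v≤n
bounded-prepend v≤n b (suc i) = shift-high-< v≤n (b i)

onto-prepend : ∀ {f : Fin n → ℕ} {v} → v ≤ n → (∀ {y} → y < n → ∃ λ i → f i ≡ y) →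
               ∀ {y} → y < suc n → ∃ λ i → prepend v f i ≡ y
onto-prepend {v = v} v≤n o {y} y<1+n with ℕ.<-cmp y v
... | tri< y<v _ _ = let i , eq = o (ℕ.<-≤-trans y<v v≤n) in
                     suc i , trans (cong (shift v) eq) (shift-below y<v)
... | tri≈ _ y≡v _ = zero , sym y≡v
onto-prepend {v = v} v≤n o {suc y} (s≤s y<n) | tri> _ _ (s≤s v≤y) =
  let i , eq = o y<n in suc i , trans (cong (shift v) eq) (shift-above v≤y)

increasing-prepend : ∀ {f : Fin n → ℕ} {v} → IncreasingFrom f v → IncreasingFrom (prepend v f) v
increasing-prepend inc {zero}  {suc j} _       s t = contradiction t (ℕ.≤⇒≯ s)
increasing-prepend inc {suc i} {suc j} (s≤s p) s t =
  inc p (≤-shift-low⁻ ℕ.≤-refl s) (shift-cancel-< _ t)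

increasing-mono : ∀ {f : Fin n → ℕ} {v w} → v ≤ w → IncreasingFrom f v → IncreasingFrom f w
increasing-mono v≤w inc p w≤ = inc p (ℕ.≤-trans v≤w w≤)

increasing⇒no-descent : ∀ {f : Fin n → ℕ} {v u} → IncreasingFrom f v → NoDescentAcross f v u
increasing⇒no-descent inc p v≤ s t = inc p v≤ (ℕ.<-≤-trans s t)

increasing-max : ∀ {f : Fin n → ℕ} → (∀ i → f i < n) → IncreasingFrom f n
increasing-max b {j = j} _ n≤ _ = contradiction (b j) (ℕ.≤⇒≯ n≤)

no-descent-max : ∀ {f : Fin n → ℕ} {v} → (∀ i → f i < n) → NoDescentAcross f v n
no-descent-max b {i = i} _ _ _ n≤ = contradiction (b i) (ℕ.≤⇒≯ n≤)

no-ascent-max : ∀ {f : Fin n → ℕ} {w} → (∀ i → f i < n) → NoAscentAcross f w n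
no-ascent-max b {j = j} _ _ _ n≤ = contradiction (b j) (ℕ.≤⇒≯ n≤)

no-ascent-refl : ∀ {f : Fin n → ℕ} {v} → NoAscentAcross f v v
no-ascent-refl _ s t _ = contradiction t (ℕ.≤⇒≯ s)

no-descent-refl : ∀ {f : Fin n → ℕ} {v} → NoDescentAcross f v v
no-descent-refl _ s t _ = contradiction t (ℕ.≤⇒≯ s)

module _ {m a : ℕ} {ls : List ℕ} {f : Fin (m ℕ.+ a) → ℕ} (st : State f (label m a ls)) where

  private
    n₀ : ℕ
    n₀ = m ℕ.+ a

  -- Nothing in f reaches n, so the extra conditions of `active-below` hold vacuously and no old
  -- site is lost; the site n gives rise to both n and n + 1.
  top-state : State (prepend (m ℕ.+ a) f) (label (m ℕ.+ a) 1 (map (m ℕ.+_) (upTo a) ++ ls))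
  top-state .size = ℕ.+-comm (m ℕ.+ a) 1
  top-state .bounded = bounded-prepend ℕ.≤-refl (bounded st)
  top-state .onto = onto-prepend ℕ.≤-refl (onto st)
  top-state .sound {v} (inj₁ (lo , hi)) with ℕ.m≤n⇒m<n∨m≡n lo
  ... | inj₂ refl = active-below ℕ.≤-refl (sound st (inj₁ (ℕ.m≤m+n m a , ℕ.≤-refl)))
                      (increasing-max (bounded st)) no-ascent-refl
  top-state .sound {suc u} (inj₁ (lo , hi)) | inj₁ (s≤s n≤u)
    with ℕ.≤-antisym n≤u (s≤s⁻¹ (subst (suc u ≤_) (ℕ.+-comm n₀ 1) hi))
  ... | refl = active-above ℕ.≤-refl (sound st (inj₁ (ℕ.m≤m+n m a , ℕ.≤-refl))) no-descent-refl
  top-state .sound (inj₂ v∈) with ∈-++⁻ (map (m ℕ.+_) (upTo a)) v∈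
  ... | inj₂ v∈ls = active-below (ℕ.≤-trans (ℕ.<⇒≤ (lows<base st v∈ls)) (ℕ.m≤m+n m a))
                      (sound st (inj₂ v∈ls)) (increasing-max (bounded st)) (no-ascent-max (bounded st))
  ... | inj₁ v∈run with ∈-map⁻ (m ℕ.+_) v∈run
  ...   | i , i∈ , refl = active-below le (sound st (inj₁ (ℕ.m≤m+n m i , le)))
                      (increasing-max (bounded st)) (no-ascent-max (bounded st))
    where le = ℕ.+-monoʳ-≤ m (ℕ.<⇒≤ (∈-upTo⁻ i∈))
  top-state .complete {v} v≤ act with ℕ.<-cmp v n₀
  ... | tri≈ _ refl _ = inj₁ (ℕ.≤-refl , ℕ.m≤m+n n₀ 1)
  ... | tri> _ _ n<v  = inj₁ (ℕ.<⇒≤ n<v , subst (v ≤_) (ℕ.+-comm 1 n₀) v≤)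
  ... | tri< v<n _ _ with complete st (ℕ.<⇒≤ v<n) (proj₁ (active-below⁻ (ℕ.<⇒≤ v<n) act))
  ...   | inj₂ v∈ls = inj₂ (∈-++⁺ʳ _ v∈ls)
  ...   | inj₁ (m≤v , _) with ℕ.m≤n⇒∃[o]m+o≡n m≤v
  ...     | o , refl = inj₂ (∈-++⁺ˡ (∈-map⁺ (m ℕ.+_) (∈-upTo⁺ (ℕ.+-cancelˡ-< m o a v<n))))
  top-state .increasing = increasing-prepend (increasing-max (bounded st))
  top-state .lows<base v∈ with ∈-++⁻ (map (m ℕ.+_) (upTo a)) v∈
  ... | inj₂ v∈ls = ℕ.<-≤-trans (lows<base st v∈ls) (ℕ.m≤m+n m a)
  ... | inj₁ v∈run with ∈-map⁻ (m ℕ.+_) v∈run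
  ...   | i , i∈ , refl = ℕ.+-monoʳ-< m (∈-upTo⁻ i∈)
  top-state .unique = Unique.++⁺ (Unique.map⁺ (ℕ.+-cancelˡ-≡ m _ _) (Unique.upTo⁺ a)) (unique st) disjoint
    where
    disjoint : ∀ {v} → ¬ (v ∈ map (m ℕ.+_) (upTo a) × v ∈ ls)
    disjoint (v∈run , v∈ls) with ∈-map⁻ (m ℕ.+_) v∈run
    ... | i , _ , refl = contradiction (lows<base st v∈ls) (ℕ.≤⇒≯ (ℕ.m≤m+n m i))
  top-state .max-first {w} w∈ = zero , suc j , s≤s z≤n ,
      trans (shift-below (bounded st j)) eq , w<n , refl
    where
    w<n = lows<base top-state w∈
    j   = proj₁ (onto st w<n)
    eq  = proj₂ (onto st w<n)
  -- Only the new front entry reaches the base n, and nothing precedes it.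
  top-state .run-first _ _ {i} {suc j} _ _ _ n≤ =
    contradiction (bounded st j) (ℕ.≤⇒≯ (≤-shift-low⁻ ℕ.≤-refl n≤))

  -- From m on the entries increase, so there is no descent that could make the new front entry
  -- harmful to a site from v on.
  run-active : ∀ {v w} → m ≤ v → v ≤ n₀ → v ≤ w → w ≤ suc n₀ → Active (prepend v f) w
  run-active m≤v v≤n v≤w w≤ with ℕ.m≤n⇒m<n∨m≡n v≤w
  ... | inj₂ refl = active-below ℕ.≤-refl (sound st (inj₁ (m≤v , v≤n)))
                      (increasing-mono m≤v (increasing st)) no-ascent-refl
  run-active {w = suc u} m≤v v≤n v≤w w≤ | inj₁ (s≤s v≤u) =
    active-above v≤u (sound st (inj₁ (ℕ.≤-trans m≤v v≤u , s≤s⁻¹ w≤)))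
      (increasing⇒no-descent (increasing-mono m≤v (increasing st)))

  -- The entries v - 1 and v of the increasing run form an ascent across v.
  run-ascent : ∀ {v w} → m < v → v < n₀ → w < v → ¬ NoAscentAcross f w v
  run-ascent {suc u} m<v v<n w<v asc with onto st (ℕ.<-trans (ℕ.n<1+n u) v<n) | onto st v<n
  ... | i , refl | j , eq with Fin.<-cmp i j
  ...   | tri< i<j _ _  = asc i<j (s≤s⁻¹ w<v) ℕ.≤-refl (ℕ.≤-reflexive (sym eq))
  ...   | tri≈ _ refl _ = contradiction eq (ℕ.<⇒≢ (ℕ.n<1+n _))
  ...   | tri> _ _ j<i  = increasing st j<i (s≤s⁻¹ m<v) (ℕ.≤-reflexive (sym eq))

  -- The new v in front of the run entries v - 1 and v, the latter raised to v + 1, is a 213. Its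
  -- smallest letter is v - 1, so every site below v is lost, the sporadic ones included.
  inside-state : ∀ {v r} → m < v → v < m ℕ.+ a → v ℕ.+ r ≡ suc (m ℕ.+ a) → State (prepend v f) (label v r [])
  inside-state {v} {r} m<v v<n size′ = record
    { size       = size′
    ; bounded    = bounded-prepend v≤n (bounded st)
    ; onto       = onto-prepend v≤n (onto st)
    ; sound      = λ { {w} (inj₁ (v≤w , w≤)) → run-active (ℕ.<⇒≤ m<v) v≤n v≤w (subst (w ≤_) size′ w≤) }
    ; complete   = complete′
    ; increasing = increasing-prepend (increasing-mono (ℕ.<⇒≤ m<v) (increasing st))
    ; lows<base  = λ ()
    ; unique     = []
    ; max-first  = λ ()
    ; run-first  = λ _ ()
    }
    where
    v≤n = ℕ.<⇒≤ v<n
    complete′ : ∀ {w} → w ≤ suc n₀ → Active (prepend v f) w → Site (label v r []) w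
    complete′ {w} w≤ act with ℕ.<-cmp w v
    ... | tri< w<v _ _  = ⊥-elim (run-ascent m<v v<n w<v (proj₂ (proj₂ (active-below⁻ (ℕ.<⇒≤ w<v) act))))
    ... | tri≈ _ refl _ = inj₁ (ℕ.≤-refl , ℕ.m≤m+n v r)
    ... | tri> _ _ v<w  = inj₁ (ℕ.<⇒≤ v<w , subst (w ≤_) (sym size′) w≤)

  -- By `max-first`, the new v is followed by the maximum n and then by the old v, raised to v + 1.
  -- This 132 excludes every site up to v, and also every w with v + 1 < w ≤ n, which fits between
  -- its last two letters. Only v + 1 and n + 1 remain.
  restart-state : ∀ {v} → v ∈ ls → State (prepend v f) (label (suc (m ℕ.+ a)) 0 (suc v ∷ []))
  restart-state {v} v∈ = record
    { size       = ℕ.+-identityʳ _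
    ; bounded    = bounded-prepend v≤n (bounded st)
    ; onto       = onto-prepend v≤n (onto st)
    ; sound      = sound′
    ; complete   = complete′
    ; increasing = increasing-max (bounded-prepend v≤n (bounded st))
    ; lows<base  = λ { (here refl) → s≤s v<n }
    ; unique     = [] ∷ []
    -- The raised entry v + 1 still follows the maximum, so the new sporadic site again satisfies
    -- the invariant.
    ; max-first  = λ { (here refl) → suc i , suc j , s≤s i<j , trans (cong (shift v) fj≡v) (shift-above ℕ.≤-refl)
                                   , ≤-shift-high (ℕ.n≤1+n v) v<fi , cong suc shift-fi }
    ; run-first  = λ ()
    }
    where
    v<n = ℕ.<-≤-trans (lows<base st v∈) (ℕ.m≤m+n m a)
    v≤n = ℕ.<⇒≤ v<n
    i    = proj₁ (max-first st v∈)
    j    = proj₁ (proj₂ (max-first st v∈))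
    i<j  = proj₁ (proj₂ (proj₂ (max-first st v∈)))
    fj≡v = proj₁ (proj₂ (proj₂ (proj₂ (max-first st v∈))))
    v<fi = proj₁ (proj₂ (proj₂ (proj₂ (proj₂ (max-first st v∈)))))
    fi≡n = proj₂ (proj₂ (proj₂ (proj₂ (proj₂ (max-first st v∈)))))
    shift-fi : shift v (f i) ≡ n₀
    shift-fi = trans (shift-above (ℕ.<⇒≤ v<fi)) fi≡n
    v≤fj = ℕ.≤-reflexive (sym fj≡v)
    sound′ : ∀ {w} → Site (label (suc n₀) 0 (suc v ∷ [])) w → Active (prepend v f) w
    sound′ (inj₂ (here refl)) = active-above ℕ.≤-refl (sound st (inj₂ v∈)) no-descent-refl
    sound′ {w} (inj₁ (lo , hi)) with ℕ.≤-antisym lo (subst (w ≤_) (ℕ.+-identityʳ _) hi)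
    ... | refl = active-above v≤n (sound st (inj₁ (ℕ.m≤m+n m a , ℕ.≤-refl))) (no-descent-max (bounded st))
    complete′ : ∀ {w} → w ≤ suc n₀ → Active (prepend v f) w → Site (label (suc n₀) 0 (suc v ∷ [])) w
    complete′ {w} w≤ act with w ℕ.≤? v
    ... | yes w≤v = ⊥-elim (proj₁ (proj₂ (active-below⁻ w≤v act)) i<j v≤fj (subst (_< f i) (sym fj≡v) v<fi))
    complete′ {zero} w≤ act | no w≰v = contradiction z≤n w≰v
    complete′ {suc u} w≤ act | no w≰v with ℕ.m≤n⇒m<n∨m≡n (s≤s⁻¹ (ℕ.≰⇒> w≰v)) | ℕ.m≤n⇒m<n∨m≡n (s≤s⁻¹ w≤)
    ... | inj₂ refl | _         = inj₂ (here refl)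
    ... | inj₁ v<u  | inj₂ refl = inj₁ (ℕ.≤-refl , ℕ.m≤m+n (suc n₀) 0)
    ... | inj₁ v<u  | inj₁ u<n  = ⊥-elim (proj₂ (active-above⁻ (ℕ.<⇒≤ v<u) act) i<j v≤fj
            (subst (_< u) (sym fj≡v) v<u) (s≤s⁻¹ (subst (suc u ≤_) (sym fi≡n) u<n)))

-- A sporadic w could only be lost to a 213 formed by the new m, an entry in [w, m) and a later
-- entry from m on. This is what `run-first` forbids, and putting m in front preserves it.
extension-state : ∀ {m b ls} {f : Fin (m ℕ.+ suc b) → ℕ} → State f (label m (suc b) ls) →
                  State (prepend m f) (label m (2 ℕ.+ b) ls)
extension-state {m} {b} {ls} {f} st = record
  { size       = ℕ.+-suc m (suc b)
  ; bounded    = bounded-prepend m≤n (bounded st)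
  ; onto       = onto-prepend m≤n (onto st)
  ; sound      = sound′
  ; complete   = complete′
  ; increasing = increasing-prepend (increasing st)
  ; lows<base  = lows<base st
  ; unique     = unique st
  ; max-first  = max-first′
  ; run-first  = λ _ → run-first′
  }
  where
  n₀ = m ℕ.+ suc b
  m<n : m < n₀
  m<n = ℕ.m<m+n m (s≤s z≤n)
  m≤n = ℕ.<⇒≤ m<n
  sound′ : ∀ {w} → Site (label m (2 ℕ.+ b) ls) w → Active (prepend m f) w
  sound′ {w} (inj₁ (lo , hi)) = run-active st ℕ.≤-refl m≤n lo (subst (w ≤_) (ℕ.+-suc m (suc b)) hi)
  sound′ (inj₂ w∈) = active-below (ℕ.<⇒≤ (lows<base st w∈)) (sound st (inj₂ w∈)) (increasing st) (run-first st (s≤s z≤n) w∈)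
  complete′ : ∀ {w} → w ≤ suc n₀ → Active (prepend m f) w → Site (label m (2 ℕ.+ b) ls) w
  complete′ {w} w≤ act with m ℕ.≤? w
  ... | yes m≤w = inj₁ (m≤w , subst (w ≤_) (sym (ℕ.+-suc m (suc b))) w≤)
  ... | no  m≰w with complete st (ℕ.≤-trans (ℕ.<⇒≤ (ℕ.≰⇒> m≰w)) m≤n) (proj₁ (active-below⁻ (ℕ.<⇒≤ (ℕ.≰⇒> m≰w)) act))
  ...   | inj₁ (m≤w , _) = contradiction m≤w m≰w
  ...   | inj₂ w∈        = inj₂ w∈
  max-first′ : ∀ {w} → w ∈ ls → ∃₂ λ i j → i Fin.< j × prepend m f j ≡ w × w < prepend m f i × suc (prepend m f i) ≡ suc n₀
  max-first′ {w} w∈ with max-first st w∈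
  ... | i , j , i<j , refl , w<fi , fi≡n =
    suc i , suc j , s≤s i<j , shift-below (lows<base st w∈)
          , ≤-shift-low (lows<base st w∈) w<fi
          -- The run is nonempty, so the maximum is at least m and is itself raised.
          , cong suc (trans (shift-above (s≤s⁻¹ (subst (m <_) (sym fi≡n) m<n))) fi≡n)
  run-first′ : ∀ {w} → w ∈ ls → NoAscentAcross (prepend m f) w m
  run-first′ w∈ {zero}          _       _ s _ = contradiction s (ℕ.<-irrefl refl)
  run-first′ w∈ {suc i} {suc j} (s≤s p) s t u =
    run-first st (s≤s z≤n) w∈ p (≤-shift-low⁻ (ℕ.<⇒≤ (lows<base st w∈)) s) (shift-low-<⁻ ℕ.≤-refl t) (≤-shift-low⁻ ℕ.≤-refl u)

-- The children of a node and its sites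

record IsInside (n m v : ℕ) (L : Label) : Set where
  field
    above  : m < v
    below  : v < n
    run    : ℕ
    shape  : L ≡ label v run []
    size   : v ℕ.+ run ≡ suc n

-- Along the list the lower end m grows while the length m + suc b stays fixed, so only the field
-- `above` has to be updated.
insides-inside : ∀ m b → All (λ (v , L) → IsInside (m ℕ.+ suc b) m v L) (insides m b)
insides-inside m zero    = []
insides-inside m (suc b) rewrite ℕ.+-suc m (suc b) =
  record { above = ℕ.≤-refl ; below = s≤s (ℕ.m<m+n m (s≤s z≤n)) ; run = 2 ℕ.+ b ; shape = refl
         ; size = cong suc (ℕ.+-suc m (suc b)) }
  ∷ All.map (λ p → record { IsInside p ; above = ℕ.<-trans (ℕ.n<1+n m) (IsInside.above p) })
            (insides-inside (suc m) b)

insides-complete : ∀ m b {v} → m < v → v < m ℕ.+ suc b → ∃ λ L → (v , L) ∈ insides m b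
insides-complete m zero    {v} m<v v<n = contradiction (subst (v <_) (ℕ.+-comm m 1) v<n) (ℕ.≤⇒≯ m<v)
insides-complete m (suc b) {v} m<v v<n with ℕ.m≤n⇒m<n∨m≡n m<v
... | inj₂ refl = _ , here refl
... | inj₁ sm<v = let L , L∈ = insides-complete (suc m) b sm<v (subst (v <_) (ℕ.+-suc m (suc b)) v<n) in L , there L∈

insides-unique : ∀ m b → Unique (map proj₁ (insides m b))
insides-unique m zero    = []
insides-unique m (suc b) =
  All.map⁺ (All.map (ℕ.<⇒≢ ∘ IsInside.above) (insides-inside (suc m) b)) ∷ insides-unique (suc m) b

kids-states : ∀ {f : Fin n → ℕ} {L} → State f L → All (λ (v , L′) → State (prepend v f) L′) (kids L)
kids-states {L = label m a ls} st with size st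
... | refl = top-state st ∷ All.++⁺ (extensions-states a st) (All.map⁺ (All.tabulate (restart-state st)))
  where
  extensions-states : ∀ a {f : Fin (m ℕ.+ a) → ℕ} → State f (label m a ls) →
                      All (λ (v , L′) → State (prepend v f) L′) (extensions (label m a ls))
  extensions-states zero    st = []
  extensions-states (suc b) st = extension-state st ∷ All.map inside (insides-inside m b)
    where
    inside : ∀ {vL} → IsInside (m ℕ.+ suc b) m (proj₁ vL) (proj₂ vL) → State _ (proj₂ vL)
    inside record { above = above ; below = below ; shape = refl ; size = size } = inside-state st above below size

extensions-range : ∀ m a ls → All (λ (v , _) → m ≤ v × v < m ℕ.+ a) (extensions (label m a ls))
extensions-range m zero    ls = []
extensions-range m (suc b) ls = (ℕ.≤-refl , ℕ.m<m+n m (s≤s z≤n)) ∷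
  All.map (λ p → ℕ.<⇒≤ (IsInside.above p) , IsInside.below p) (insides-inside m b)

kids-sites : ∀ L {v L′} → (v , L′) ∈ kids L → Site L v
kids-sites (label m a ls) (here refl) = inj₁ (ℕ.m≤m+n m a , ℕ.≤-refl)
kids-sites L@(label m a ls) (there v∈) with ∈-++⁻ (extensions L) v∈
... | inj₁ v∈ext = let m≤v , v<n = All.lookup (extensions-range m a ls) v∈ext in inj₁ (m≤v , ℕ.<⇒≤ v<n)
... | inj₂ v∈res with ∈-map⁻ (restart (m ℕ.+ a)) v∈res
...   | _ , v∈ls , refl = inj₂ v∈ls

sites-kids : ∀ L {v} → Site L v → ∃ λ L′ → (v , L′) ∈ kids L
sites-kids L@(label m a ls) (inj₂ v∈) = _ , there (∈-++⁺ʳ (extensions L) (∈-map⁺ (restart (m ℕ.+ a)) v∈))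
sites-kids L@(label m a ls) {v} (inj₁ (m≤v , v≤n)) with ℕ.m≤n⇒m<n∨m≡n v≤n
... | inj₂ refl = _ , here refl
... | inj₁ v<n  = let L′ , L′∈ = extensions-complete a v<n in L′ , there (∈-++⁺ˡ L′∈)
  where
  extensions-complete : ∀ a → v < m ℕ.+ a → ∃ λ L′ → (v , L′) ∈ extensions (label m a ls)
  extensions-complete zero    v<n = contradiction (subst (v <_) (ℕ.+-identityʳ m) v<n) (ℕ.≤⇒≯ m≤v)
  extensions-complete (suc b) v<n with ℕ.m≤n⇒m<n∨m≡n m≤v
  ... | inj₂ refl = _ , here refl
  ... | inj₁ m<v  = let L′ , L′∈ = insides-complete m b m<v v<n in L′ , there L′∈

-- The three kinds of children prepend values from disjoint ranges: n, the values from m to n - 1,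
-- and those below m.
kids-unique : ∀ {f : Fin n → ℕ} {L} → State f L → Unique (map proj₁ (kids L))
kids-unique {L = L@(label m a ls)} st =
  All.map⁺ (All.++⁺ (All.map (λ (_ , v<n) → ≢-sym (ℕ.<⇒≢ v<n)) (extensions-range m a ls))
                    (All.map⁺ (All.tabulate λ v∈ → ≢-sym (ℕ.<⇒≢ (ℕ.<-≤-trans (lows<base st v∈) (ℕ.m≤m+n m a))))))
  ∷ subst Unique (sym (map-++ proj₁ (extensions L) _))
      (Unique.++⁺ (extensions-unique a)
                  (subst Unique (trans (sym (map-id ls)) (map-∘ ls)) (unique st)) disjoint)
  where
  extensions-unique : ∀ a → Unique (map proj₁ (extensions (label m a ls)))
  extensions-unique zero    = []
  extensions-unique (suc b) = All.map⁺ (All.map (ℕ.<⇒≢ ∘ IsInside.above) (insides-inside m b)) ∷ insides-unique m b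
  disjoint : ∀ {v} → ¬ (v ∈ map proj₁ (extensions L) × v ∈ map proj₁ (map (restart (m ℕ.+ a)) ls))
  disjoint (v∈ext , v∈res) with ∈-map⁻ proj₁ v∈ext | ∈-map⁻ proj₁ v∈res
  ... | _ , ext∈ , refl | _ , res∈ , eq with ∈-map⁻ (restart (m ℕ.+ a)) res∈
  ...   | w , w∈ , refl = contradiction (lows<base st (subst (_∈ ls) (sym eq) w∈))
                            (ℕ.≤⇒≯ (proj₁ (All.lookup (extensions-range m a ls) ext∈)))

-- Nodes of the tree as permutations

-- A permutation is coded by its entries, each standardised with respect to
-- the entries to its right.
decode : Vec ℕ n → Fin n → ℕ
decode (v ∷ c) = prepend v (decode c)

grow : Vec ℕ n × Label → List (Vec ℕ (suc n) × Label)
grow (c , L) = map (λ (v , L′) → v ∷ c , L′) (kids L)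

root : Label
root = label 0 0 []

nodes : ∀ n → List (Vec ℕ n × Label)
nodes zero    = ([] , root) ∷ []
nodes (suc n) = concatMap grow (nodes n)

total-concatMap : ∀ (w : B → ℤ) (f : A → List B) as → total w (concatMap f as) ≡ total (total w ∘ f) as
total-concatMap w f []       = refl
total-concatMap w f (a ∷ as) = trans (total-++ w (f a) _) (cong (λ t → total w (f a) ℤ.+ t) (total-concatMap w f as))

total-cong : ∀ {A : Set} {w w′ : A → ℤ} → w ≗ w′ → total w ≗ total w′
total-cong w≗w′ []       = refl
total-cong w≗w′ (a ∷ as) = cong₂ ℤ._+_ (w≗w′ a) (total-cong w≗w′ as)

-- Looking k generations below generation n + 1 is looking k + 1 generations below generation n, by
-- `kids-total`; hence k varies in the induction. At k = 0 every weight is 1 and the sum counts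
-- nodes.
nodes-total : ∀ n k → total (weight k ∘ proj₂) (nodes n) ≡ weight (n ℕ.+ k) root
nodes-total zero    k = ℤ.+-identityʳ (weight k root)
nodes-total (suc n) k = begin
  total (weight k ∘ proj₂) (concatMap grow (nodes n)) ≡⟨ total-concatMap _ grow (nodes n) ⟩
  total (total (weight k ∘ proj₂) ∘ grow) (nodes n)   ≡⟨ total-cong grow-total (nodes n) ⟩
  total (weight (suc k) ∘ proj₂) (nodes n)            ≡⟨ nodes-total n (suc k) ⟩
  weight (n ℕ.+ suc k) root                           ≡⟨ cong (λ t → weight t root) (ℕ.+-suc n k) ⟩
  weight (suc n ℕ.+ k) root                           ∎
  where
  grow-total : ∀ cL → total (weight k ∘ proj₂) (grow cL) ≡ weight (suc k) (proj₂ cL)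
  grow-total (c , L) = trans (total-map (weight k ∘ proj₂) _ (kids L)) (kids-total k L)

weight-zero : ∀ L → weight 0 L ≡ 1ℤ
weight-zero (label m zero    ls) = cong (λ t → 1ℤ ℤ.+ t) (ℤ.*-zeroʳ (+ length ls))
weight-zero (label m (suc a) ls) = cong (λ t → 1ℤ ℤ.+ t) (ℤ.*-zeroʳ (+ length ls))

length-nodes : ∀ n → + length (nodes n) ≡ weight n root
length-nodes n = begin
  + length (nodes n)                 ≡⟨ ℤ.*-identityʳ _ ⟨
  + length (nodes n) ℤ.* 1ℤ          ≡⟨ total-const 1ℤ (nodes n) ⟨
  total (λ _ → 1ℤ) (nodes n)         ≡⟨ total-cong (weight-zero ∘ proj₂) (nodes n) ⟨
  total (weight 0 ∘ proj₂) (nodes n) ≡⟨ nodes-total n 0 ⟩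
  weight (n ℕ.+ 0) root              ≡⟨ cong (λ t → weight t root) (ℕ.+-identityʳ n) ⟩
  weight n root                      ∎

root-state : State (decode []) root
root-state = record
  { size       = refl
  ; bounded    = λ ()
  ; onto       = λ ()
  ; sound      = λ _ → record { no132 = λ { {()} } ; no213 = λ { {()} } ; no1v32 = λ { {()} } }
  ; complete   = λ v≤ _ → inj₁ (z≤n , v≤)
  ; increasing = λ { {()} }
  ; lows<base  = λ ()
  ; unique     = []
  ; max-first  = λ ()
  ; run-first  = λ ()
  }

All-concatMap : ∀ {P : A → Set} {Q : B → Set} {f : A → List B} →
                (∀ {a} → P a → All Q (f a)) → ∀ {as} → All P as → All Q (concatMap f as)
All-concatMap g []       = []
All-concatMap g (p ∷ ps) = All.++⁺ (g p) (All-concatMap g ps)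

nodes-states : ∀ n → All (λ (c , L) → State (decode c) L) (nodes n)
nodes-states zero    = root-state ∷ []
nodes-states (suc n) = All-concatMap (λ st → All.map⁺ (kids-states st)) (nodes-states n)

nodes-good : ∀ n → All (λ (c , L) → Good (decode c)) (nodes n)
nodes-good zero    = record { no1243 = λ { {()} } ; no1324 = λ { {()} } ; no3142 = λ { {()} } } ∷ []
nodes-good (suc n) = All-concatMap
  (λ { {c , L} (st , good) → All.map⁺ (All.tabulate λ {(v , L′)} v∈ → Good-prepend good (sound st (kids-sites L v∈))) })
  (All.zip (nodes-states n , nodes-good n))

-- Codes from different parents differ in their tails, codes from the same parent in their heads.
nodes-unique : ∀ n → Unique (map proj₁ (nodes n))
nodes-unique zero    = [] ∷ []
nodes-unique (suc n) = go (nodes-states n) (nodes-unique n)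
  where
  grow-tails : ∀ (cL : Vec ℕ n × Label) {vc} → vc ∈ map proj₁ (grow cL) → Vec.tail vc ≡ proj₁ cL
  grow-tails cL vc∈ with ∈-map⁻ proj₁ {xs = grow cL} vc∈
  ... | _ , p , refl with ∈-map⁻ (λ (v , L′) → v ∷ proj₁ cL , L′) {xs = kids (proj₂ cL)} p
  ...   | _ , _ , refl = refl
  concat-tails : ∀ cLs {vc} → vc ∈ map proj₁ (concatMap grow cLs) → Vec.tail vc ∈ map proj₁ cLs
  concat-tails (cL ∷ cLs) {vc} vc∈ with ∈-++⁻ (map proj₁ (grow cL)) (subst (vc ∈_) (map-++ proj₁ (grow cL) _) vc∈)
  ... | inj₁ p = here (grow-tails cL p)
  ... | inj₂ p = there (concat-tails cLs p)
  go : ∀ {cLs : List (Vec ℕ n × Label)} → All (λ (c , L) → State (decode c) L) cLs →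
       Unique (map proj₁ cLs) → Unique (map proj₁ (concatMap grow cLs))
  go {[]}            []         _            = []
  go {(c , L) ∷ cLs} (st ∷ sts) (c≢ ∷ uniq) = subst Unique (sym (map-++ proj₁ (grow (c , L)) _))
    (Unique.++⁺ grow-unique (go sts uniq) λ (p , q) → All.lookup c≢ (concat-tails cLs q) (sym (grow-tails (c , L) p)))
    where
    grow-unique : Unique (map proj₁ (grow (c , L)))
    grow-unique = subst Unique (trans (sym (map-∘ (kids L))) (map-∘ (kids L)))
      (Unique.map⁺ {f = _∷ c} Vec.∷-injectiveˡ (kids-unique st))

-- Comparison with the words of Defs

values : Vec (Fin n) n → Fin n → ℕ
values π = toℕ ∘ lookup π

chain-mono : ∀ (c : Vec ℕ 4) → lookup c 0F < lookup c 1F → lookup c 1F < lookup c 2F → lookup c 2F < lookup c 3F →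
             ∀ {a b} → a Fin.< b → lookup c a < lookup c b
chain-mono (_ ∷ _ ∷ _ ∷ _ ∷ []) p q r {0F} {1F} _ = p
chain-mono (_ ∷ _ ∷ _ ∷ _ ∷ []) p q r {0F} {2F} _ = ℕ.<-trans p q
chain-mono (_ ∷ _ ∷ _ ∷ _ ∷ []) p q r {0F} {3F} _ = ℕ.<-trans p (ℕ.<-trans q r)
chain-mono (_ ∷ _ ∷ _ ∷ _ ∷ []) p q r {1F} {2F} _ = q
chain-mono (_ ∷ _ ∷ _ ∷ _ ∷ []) p q r {1F} {3F} _ = ℕ.<-trans q r
chain-mono (_ ∷ _ ∷ _ ∷ _ ∷ []) p q r {2F} {3F} _ = r
chain-mono (_ ∷ _ ∷ _ ∷ _ ∷ []) p q r {1F} {1F} (s≤s ())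
chain-mono (_ ∷ _ ∷ _ ∷ _ ∷ []) p q r {2F} {1F} (s≤s ())
chain-mono (_ ∷ _ ∷ _ ∷ _ ∷ []) p q r {2F} {2F} (s≤s (s≤s ()))
chain-mono (_ ∷ _ ∷ _ ∷ _ ∷ []) p q r {3F} {1F} (s≤s ())
chain-mono (_ ∷ _ ∷ _ ∷ _ ∷ []) p q r {3F} {2F} (s≤s (s≤s ()))
chain-mono (_ ∷ _ ∷ _ ∷ _ ∷ []) p q r {3F} {3F} (s≤s (s≤s (s≤s ())))

mono⇒cancel : ∀ {k} {c : Fin k → ℕ} → (∀ {a b} → a Fin.< b → c a < c b) → ∀ {a b} → c a < c b → a Fin.< b
mono⇒cancel mono {a} {b} lt with Fin.<-cmp a b
... | tri< a<b _ _  = a<b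
... | tri≈ _ refl _ = contradiction lt (ℕ.<-irrefl refl)
... | tri> _ _ b<a  = contradiction lt (ℕ.<-asym (mono b<a))

-- The letters of τ are ranked by r, and c lists the values at the positions ps
-- in increasing order.
order-isomorphic : ∀ (π : Vec (Fin n) n) τ ps (r : Fin (length τ) → Fin 4) (c : Vec ℕ 4) →
  (∀ a b → (List.lookup τ a < List.lookup τ b) ⇔ (r a Fin.< r b)) →
  (∀ a → values π (lookup ps a) ≡ lookup c (r a)) →
  lookup c 0F < lookup c 1F → lookup c 1F < lookup c 2F → lookup c 2F < lookup c 3F →
  OrderIsomorphicAt π τ ps
order-isomorphic π τ ps r c rank val p q s a b rewrite val a | val b = mk⇔
  (λ lt → Equivalence.from (rank a b) (mono⇒cancel (chain-mono c p q s) lt))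
  (λ lt → chain-mono c p q s (Equivalence.to (rank a b) lt))

patterns : List (List ℕ)
patterns = (1 ∷ 2 ∷ 4 ∷ 3 ∷ []) ∷ (1 ∷ 3 ∷ 2 ∷ 4 ∷ []) ∷ (3 ∷ 1 ∷ 4 ∷ 2 ∷ []) ∷ []

positions-increase : ∀ {i j k l : Fin n} → i Fin.< j → j Fin.< k → k Fin.< l →
                     VecAllPairs.AllPairs Fin._<_ (i ∷ j ∷ k ∷ l ∷ [])
positions-increase {i = i} {j} {k} {l} p q r =
  (p ∷ Fin.<-trans {i = i} {j} {k} p q ∷ Fin.<-trans {i = i} {j} {l} p (Fin.<-trans {i = j} {k} {l} q r) ∷ []) ∷
  (q ∷ Fin.<-trans {i = j} {k} {l} q r ∷ []) ∷ (r ∷ []) ∷ [] ∷ []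

rank? : ∀ τ (r : Vec (Fin 4) (length τ)) →
        Dec (∀ a b → (List.lookup τ a < List.lookup τ b) ⇔ (lookup r a Fin.< lookup r b))
rank? τ r = Fin.all? λ a → Fin.all? λ b → (List.lookup τ a ℕ.<? List.lookup τ b) ⇔-dec (lookup r a Fin.<? lookup r b)

avoids⇒good : ∀ (π : Vec (Fin n) n) → Avoids π patterns → Good (values π)
avoids⇒good π (av ∷ _ ∷ _ ∷ []) .no1243 {i} {j} {k} {l} p q r s t u = av
  ( i ∷ j ∷ k ∷ l ∷ [] , positions-increase p q r
  , order-isomorphic π (1 ∷ 2 ∷ 4 ∷ 3 ∷ []) (i ∷ j ∷ k ∷ l ∷ []) (lookup (0F ∷ 1F ∷ 3F ∷ 2F ∷ []))
      (values π i ∷ values π j ∷ values π l ∷ values π k ∷ [])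
      (from-yes (rank? (1 ∷ 2 ∷ 4 ∷ 3 ∷ []) (0F ∷ 1F ∷ 3F ∷ 2F ∷ [])))
      (λ { 0F → refl ; 1F → refl ; 2F → refl ; 3F → refl }) s t u)
avoids⇒good π (_ ∷ av ∷ _ ∷ []) .no1324 {i} {j} {k} {l} p q r s t u = av
  ( i ∷ j ∷ k ∷ l ∷ [] , positions-increase p q r
  , order-isomorphic π (1 ∷ 3 ∷ 2 ∷ 4 ∷ []) (i ∷ j ∷ k ∷ l ∷ []) (lookup (0F ∷ 2F ∷ 1F ∷ 3F ∷ []))
      (values π i ∷ values π k ∷ values π j ∷ values π l ∷ [])
      (from-yes (rank? (1 ∷ 3 ∷ 2 ∷ 4 ∷ []) (0F ∷ 2F ∷ 1F ∷ 3F ∷ [])))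
      (λ { 0F → refl ; 1F → refl ; 2F → refl ; 3F → refl }) s t u)
avoids⇒good π (_ ∷ _ ∷ av ∷ []) .no3142 {i} {j} {k} {l} p q r s t u = av
  ( i ∷ j ∷ k ∷ l ∷ [] , positions-increase p q r
  , order-isomorphic π (3 ∷ 1 ∷ 4 ∷ 2 ∷ []) (i ∷ j ∷ k ∷ l ∷ []) (lookup (2F ∷ 0F ∷ 3F ∷ 1F ∷ []))
      (values π j ∷ values π l ∷ values π i ∷ values π k ∷ [])
      (from-yes (rank? (3 ∷ 1 ∷ 4 ∷ 2 ∷ []) (2F ∷ 0F ∷ 3F ∷ 1F ∷ [])))
      (λ { 0F → refl ; 1F → refl ; 2F → refl ; 3F → refl }) s t u)

good⇒avoids : ∀ (π : Vec (Fin n) n) → Good (values π) → Avoids π patterns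
good⇒avoids π good =
  (λ { (i ∷ j ∷ k ∷ l ∷ [] , (p ∷ _) ∷ (q ∷ _) ∷ (r ∷ []) ∷ [] ∷ [] , iso) →
         no1243 good p q r (Equivalence.from (iso 0F 1F) (ℕ.n<1+n 1)) (Equivalence.from (iso 1F 3F) (ℕ.n<1+n 2))
           (Equivalence.from (iso 3F 2F) (ℕ.n<1+n 3)) }) ∷
  (λ { (i ∷ j ∷ k ∷ l ∷ [] , (p ∷ _) ∷ (q ∷ _) ∷ (r ∷ []) ∷ [] ∷ [] , iso) →
         no1324 good p q r (Equivalence.from (iso 0F 2F) (ℕ.n<1+n 1)) (Equivalence.from (iso 2F 1F) (ℕ.n<1+n 2))
           (Equivalence.from (iso 1F 3F) (ℕ.n<1+n 3)) }) ∷
  (λ { (i ∷ j ∷ k ∷ l ∷ [] , (p ∷ _) ∷ (q ∷ _) ∷ (r ∷ []) ∷ [] ∷ [] , iso) →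
         no3142 good p q r (Equivalence.from (iso 1F 3F) (ℕ.n<1+n 1)) (Equivalence.from (iso 3F 0F) (ℕ.n<1+n 2))
           (Equivalence.from (iso 0F 2F) (ℕ.n<1+n 3)) }) ∷ []

Good-resp-≗ : ∀ {f g : Fin n → ℕ} → f ≗ g → Good f → Good g
Good-resp-≗ {f = f} {g} f≗g good = record
  { no1243 = λ p q r s t u → no1243 good p q r (transport s) (transport t) (transport u)
  ; no1324 = λ p q r s t u → no1324 good p q r (transport s) (transport t) (transport u)
  ; no3142 = λ p q r s t u → no3142 good p q r (transport s) (transport t) (transport u)
  }
  where
  transport : ∀ {i j} → g i < g j → f i < f j
  transport {i} {j} = subst₂ _<_ (sym (f≗g i)) (sym (f≗g j))

-- The values of `decode` as a vector, so that they can be compared by propositional equality and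
-- collected in lists.
table : Vec ℕ n → Vec ℕ n
table []      = []
table (v ∷ c) = v ∷ Vec.map (shift v) (table c)

lookup-table : ∀ (c : Vec ℕ n) → lookup (table c) ≗ decode c
lookup-table (v ∷ c) zero    = refl
lookup-table (v ∷ c) (suc i) = trans (Vec.lookup-map i (shift v) (table c)) (cong (shift v) (lookup-table c i))

map-injective : ∀ {f : A → B} → (∀ {a b} → f a ≡ f b → a ≡ b) →
                ∀ {as bs : Vec A n} → Vec.map f as ≡ Vec.map f bs → as ≡ bs
map-injective inj {[]}     {[]}     _  = refl
map-injective inj {a ∷ as} {b ∷ bs} eq =
  cong₂ _∷_ (inj (Vec.∷-injectiveˡ eq)) (map-injective inj (Vec.∷-injectiveʳ eq))

table-injective : ∀ {c d : Vec ℕ n} → table c ≡ table d → c ≡ d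
table-injective {c = []}    {[]}    _  = refl
table-injective {c = v ∷ c} {w ∷ d} eq with Vec.∷-injectiveˡ eq
... | refl = cong (v ∷_) (table-injective (map-injective (shift-injective v) (Vec.∷-injectiveʳ eq)))

toℕ-punchIn : ∀ (i : Fin (suc n)) j → toℕ (punchIn i j) ≡ shift (toℕ i) (toℕ j)
toℕ-punchIn zero    j       = refl
toℕ-punchIn (suc i) zero    = refl
toℕ-punchIn (suc i) (suc j) = cong suc (toℕ-punchIn i j)

map-punchIn : ∀ {k} (i : Fin (suc n)) (w : Vec (Fin n) k) →
              Vec.map toℕ (Vec.map (punchIn i) w) ≡ Vec.map (shift (toℕ i)) (Vec.map toℕ w)
map-punchIn i w = begin
  Vec.map toℕ (Vec.map (punchIn i) w)     ≡⟨ Vec.map-∘ toℕ (punchIn i) w ⟨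
  Vec.map (toℕ ∘ punchIn i) w             ≡⟨ Vec.map-cong (toℕ-punchIn i) w ⟩
  Vec.map (shift (toℕ i) ∘ toℕ) w         ≡⟨ Vec.map-∘ (shift (toℕ i)) toℕ w ⟩
  Vec.map (shift (toℕ i)) (Vec.map toℕ w) ∎

punchOut-word : ∀ {k} (i : Fin (suc n)) {w : Vec (Fin (suc n)) k} → VecAll.All (i ≢_) w →
                ∃ λ w′ → Vec.map (punchIn i) w′ ≡ w
punchOut-word i []          = [] , refl
punchOut-word i (i≢j ∷ i≢w) =
  let w′ , eq = punchOut-word i i≢w in Fin.punchOut i≢j ∷ w′ , cong₂ _∷_ (Fin.punchIn-punchOut i≢j) eq

unique-map⁻ : ∀ {f : A → B} {as : Vec A n} → VecUnique.Unique (Vec.map f as) → VecUnique.Unique as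
unique-map⁻ {as = []}     []       = []
unique-map⁻ {as = a ∷ as} (p ∷ ps) = VecAll.map (λ ne → ne ∘ cong _) (VecAll.map⁻ p) ∷ unique-map⁻ ps

site-bounded : ∀ {f : Fin n → ℕ} {L} → State f L → ∀ {v} → Site L v → v ≤ n
site-bounded st (inj₁ (_ , v≤)) = subst (_ ≤_) (size st) v≤
site-bounded {L = label m a ls} st (inj₂ v∈) =
  ℕ.≤-trans (ℕ.<⇒≤ (lows<base st v∈)) (subst (m ≤_) (size st) (ℕ.m≤m+n m a))

Spells : Vec ℕ n → Vec (Fin n) n → Set
Spells c π = table c ≡ Vec.map toℕ π

spells-values : ∀ {c : Vec ℕ n} {π} → Spells c π → decode c ≗ values π
spells-values {c = c} {π} eq i = begin
  decode c i               ≡⟨ lookup-table c i ⟨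
  lookup (table c) i       ≡⟨ cong (λ w → lookup w i) eq ⟩
  lookup (Vec.map toℕ π) i ≡⟨ Vec.lookup-map i toℕ π ⟩
  toℕ (lookup π i)         ∎

nodes-spell : ∀ n → All (λ (c , L) → ∃ λ π → VecUnique.Unique π × Spells c π) (nodes n)
nodes-spell zero    = ([] , [] , refl) ∷ []
nodes-spell (suc n) = All-concatMap
  (λ { {c , L} (st , spelt) → All.map⁺ (All.tabulate λ {(v , L′)} v∈ → step spelt (site-bounded st (kids-sites L v∈))) })
  (All.zip (nodes-states n , nodes-spell n))
  where
  step : ∀ {c : Vec ℕ n} {v} → (∃ λ π → VecUnique.Unique π × Spells c π) → v ≤ n →
         ∃ λ π → VecUnique.Unique π × Spells (v ∷ c) π
  step {c} {v} (π , uniq , eq) v≤n =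
    i ∷ Vec.map (punchIn i) π
    , VecAll.map⁺ (VecAll.universal (λ j → ≢-sym (Fin.punchInᵢ≢i i j)) π) ∷ VecUnique.map⁺ (Fin.punchIn-injective i _ _) uniq
    , cong₂ _∷_ (sym i≡v) (trans (cong₂ (λ u w → Vec.map (shift u) w) (sym i≡v) eq) (sym (map-punchIn i π)))
    where
    i   = fromℕ< (s≤s v≤n)
    i≡v = Fin.toℕ-fromℕ< (s≤s v≤n)

-- The code comes from standardising the tail, for any permutation. Goodness is assumed only
-- afterwards and for the decoded function, where `Good-tail` passes it on to the shorter code.
nodes-complete : ∀ {n} (π : Vec (Fin n) n) → VecUnique.Unique π →
                 ∃ λ c → Spells c π × (Good (decode c) → ∃ λ L → (c , L) ∈ nodes n)
nodes-complete []      [] = [] , refl , λ _ → root , here refl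
nodes-complete {suc n} (v ∷ w) (v≢w ∷ uniq) with punchOut-word v v≢w
... | w′ , refl with nodes-complete w′ (unique-map⁻ uniq)
...   | c , eq , found = toℕ v ∷ c
      , cong (toℕ v ∷_) (trans (cong (Vec.map (shift (toℕ v))) eq) (sym (map-punchIn v w′)))
      , λ good → grow-node good (found (Good-tail good))
  where
  grow-node : Good (prepend (toℕ v) (decode c)) → (∃ λ L → (c , L) ∈ nodes n) → ∃ λ L → (toℕ v ∷ c , L) ∈ nodes (suc n)
  grow-node good (L , L∈) =
    let site       = complete (All.lookup (nodes-states n) L∈) (s≤s⁻¹ (Fin.toℕ<n v)) (Good-head good)
        L′ , L′∈   = sites-kids L site
    in L′ , ∈-concatMap⁺ grow {xs = nodes n} (lose L∈ (∈-map⁺ _ L′∈))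

words-unique : ∀ n k → Unique (words n k)
words-unique n zero    = [] ∷ []
words-unique n (suc k) = Unique.cartesianProductWith⁺ _∷_ Vec.∷-injective (Unique.allFin⁺ n) (words-unique n k)

words-complete : ∀ {k} (w : Vec (Fin n) k) → w ∈ words n k
words-complete []      = here refl
words-complete (i ∷ w) = ∈-cartesianProductWith⁺ _∷_ (∈-allFin i) (words-complete w)

-- T is abstract because S n T runs a decision procedure on T, which must not be unfolded.
module _ {T : List (List ℕ)} (avoids⇔good : ∀ {n} (π : Vec (Fin n) n) → Avoids π T ⇔ Good (values π)) where

  valid? : (π : Vec (Fin n) n) → Dec (VecUnique.Unique π × Avoids π T)
  valid? π = unique? π ×-dec avoids? π T

  avoider⇒table : ∀ {t} → t ∈ map (Vec.map toℕ) (S n T) → t ∈ map table (map proj₁ (nodes n))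
  avoider⇒table {n} t∈ with ∈-map⁻ (Vec.map toℕ) t∈
  ... | π , π∈ , refl with ∈-filter⁻ valid? {xs = words n n} π∈
  ...   | _ , uniq , av with nodes-complete π uniq
  ...     | c , eq , found =
    let good   = Good-resp-≗ (sym ∘ spells-values {c = c} {π} eq) (Equivalence.to (avoids⇔good π) av)
        L , L∈ = found good
    in subst (_∈ map table (map proj₁ (nodes n))) eq (∈-map⁺ table (∈-map⁺ proj₁ L∈))

  table⇒avoider : ∀ {t} → t ∈ map table (map proj₁ (nodes n)) → t ∈ map (Vec.map toℕ) (S n T)
  table⇒avoider {n} t∈ with ∈-map⁻ table t∈
  ... | c , c∈ , refl with ∈-map⁻ proj₁ c∈
  ...   | (_ , L) , L∈ , refl with All.lookup (nodes-spell n) L∈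
  ...     | π , uniq , eq = subst (_∈ map (Vec.map toℕ) (S n T)) (sym eq)
    (∈-map⁺ (Vec.map toℕ) (∈-filter⁺ valid? (words-complete π) (uniq , Equivalence.from (avoids⇔good π) good)))
    where good = Good-resp-≗ (spells-values {c = c} {π} eq) (All.lookup (nodes-good n) L∈)

  -- Words and codes have different types, so both lists are mapped injectively to vectors over ℕ.
  -- There they are duplicate-free with the same members, hence permutations of each other.
  length-S : ∀ n → length (S n T) ≡ length (nodes n)
  length-S n = begin
    length (S n T)                     ≡⟨ length-map (Vec.map toℕ) (S n T) ⟨
    length (map (Vec.map toℕ) (S n T)) ≡⟨ ↭-length (∼bag⇒↭ (unique∧set⇒bag unique-words unique-tables
                                                                     (mk⇔ avoider⇒table table⇒avoider))) ⟩
    length (map table (map proj₁ (nodes n))) ≡⟨ length-map table (map proj₁ (nodes n)) ⟩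
    length (map proj₁ (nodes n))             ≡⟨ length-map proj₁ (nodes n) ⟩
    length (nodes n)                         ∎
    where
    unique-words : Unique (map (Vec.map toℕ) (S n T))
    unique-words = Unique.map⁺ (map-injective Fin.toℕ-injective) (Unique.filter⁺ valid? (words-unique n n))
    unique-tables : Unique (map table (map proj₁ (nodes n)))
    unique-tables = Unique.map⁺ table-injective (nodes-unique n)

theorem28 : F ((1 ∷ 2 ∷ 4 ∷ 3 ∷ []) ∷ (1 ∷ 3 ∷ 2 ∷ 4 ∷ []) ∷ (3 ∷ 1 ∷ 4 ∷ 2 ∷ []) ∷ [])
    ≗ (con 1 - con 3 * x + x ^ 2) / (con 1 - x) * C ^ 3
theorem28 n = begin
  + length (S n patterns)             ≡⟨ cong +_ (length-S (λ π → mk⇔ (avoids⇒good π) (good⇒avoids π)) n) ⟩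
  + length (nodes n)                  ≡⟨ length-nodes n ⟩
  -- The root has no sporadic site, so the term linear in s vanishes.
  weight n root                       ≡⟨ ℤ.+-identityʳ (K 0 n ℤ.- δ n) ⟩
  K 0 n ℤ.- δ n                       ≡⟨ rhs-coefficients n ⟨
  (numerator / (con 1 - x) * C ^ 3) n ∎
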